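{- Every countable ordinal $\alpha<\omega_1$ arises as the game value (for the designated open player) of some open game of Infinite Draughts. Hence the omega one of the class of open games of Infinite Draughts is $\omega_1^{\rm Draughts}=\omega_1$.
   Context: Games. A game is a two-player game of perfect information whose game tree is a rooted tree embeddable into the tree $\omega^{<\omega}$ of finite sequences of natural numbers ordered by extension (so every position has at most countably many successors and every play has length at most $\omega$). Players alternate moves; a play is a maximal branch; each player has a set of winning plays, the two sets being disjoint, and all other plays are draws. Plays carry the topology whose basic open sets are $U(v)=\{$plays passing through position $v\}$. A game is open for a player if that player's set of winning plays is open (every win by that player is decided at a finite stage). Game value: for a game open for player $O$ with opponent $C$, positions receive ordinal values by recursion: a position $p$ at which $O$ has already won (every play through $p$ is a win for $O$) has value $0$; if $O$ is to move at $p$, some successor of $p$ has a value, and $\alpha$ is the least value of such successors, then $p$ has value $\alpha+1$; if $C$ is to move at $p$ and all successors of $p$ have values, then $p$ has value equal to the supremum of these values. Positions not assigned a value in this way have no value. The game value of a game is the value of its initial position. The omega one of a class of games, all open for a designated player, is the supremum of the game values (for that player) of the games in the class that have a value. Infinite Draughts. The board is the set of white squares of the infinite chessboard (in bijection with $\mathbb{Z}\times\mathbb{Z}$), oriented North–South. Pieces are Black or White pawns or kings. A position assigns to each square either nothing or one piece, and specifies who moves next; an initial position may contain infinitely many pieces. On his turn a player moves one of his pieces: a simple move takes it to an empty diagonally adjacent square; a jump is possible when a diagonally adjacent square holds an opponent's piece and the next square beyond it on the same diagonal is empty: the piece jumps to that empty square and the jumped piece is removed; an iterated jump is a sequence of jumps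 by the same piece and counts as a single move. Kings move and jump in all four diagonal directions; Black pawns only towards North, White pawns only towards South. A player who cannot make a legal move (in particular one with no pieces left) loses; infinite plays are draws. The following rules are assumed: (Forced Jump) a player must make a jump move whenever one is legal; (Finite Iteration) an iterated jump may consist only of finitely many jumps (a player may stop iterating after any finite number of jumps). -}

module Defs where

open import Data.Nat using (ℕ)
open import Data.Integer using (ℤ; _+_; _-_; 1ℤ)
import Data.Integer as ℤ
open import Data.Product using (_×_; _,_; Σ; ∃)
open import Data.Product.Properties using (≡-dec)
open import Data.Maybe using (Maybe; just; nothing)
open import Data.Empty using (⊥)
open import Relation.Nullary using (¬_; yes; no)
open import Relation.Binary.PropositionalEquality using (_≡_)
open import Relation.Binary.Construct.Closure.ReflexiveTransitive using (Star)

-- Countable ordinals: Brouwer trees (every countable ordinal α < ω₁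
-- is represented, and every Brouwer tree denotes a countable ordinal).

data Ord : Set where
  ozero : Ord
  osuc  : Ord → Ord
  olim  : (ℕ → Ord) → Ord      -- supremum of a countable family

infix 4 _≤ₒ_ _≈ₒ_
data _≤ₒ_ : Ord → Ord → Set where
  ≤-zero  : ∀ {β} → ozero ≤ₒ β
  ≤-suc   : ∀ {α β} → α ≤ₒ β → osuc α ≤ₒ osuc β
  ≤-limˡ  : ∀ {f β} → (∀ n → f n ≤ₒ β) → olim f ≤ₒ β
  ≤-limʳ  : ∀ {α f} n → α ≤ₒ f n → α ≤ₒ olim f

_≈ₒ_ : Ord → Ord → Set
α ≈ₒ β = (α ≤ₒ β) × (β ≤ₒ α)

-- Infinite Draughts.
-- White squares of the infinite chessboard, in bijection with ℤ × ℤ via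
-- chessboard coordinates (x , y) (x + y even) ↦ ((x + y)/2 , (y − x)/2).
-- In these coordinates the four diagonal neighbours of (a , b) are:
--   NE = (a+1 , b), NW = (a , b+1)   (towards North)
--   SW = (a−1 , b), SE = (a , b−1)   (towards South)

data Colour : Set where
  black white : Colour

opp : Colour → Colour
opp black = white
opp white = black

data Kind : Set where
  pawn king : Kind

Piece : Set
Piece = Colour × Kind

Square : Set
Square = ℤ × ℤ

Board : Set
Board = Square → Maybe Piece

record State : Set where
  constructor ⟨_,_⟩
  field
    board  : Board
    toMove : Colour
open State public

data Dir : Set where
  NE NW SE SW : Dir

step : Dir → Square → Square
step NE (a , b) = (a + 1ℤ , b)
step NW (a , b) = (a , b + 1ℤ)
step SW (a , b) = (a - 1ℤ , b)
step SE (a , b) = (a , b - 1ℤ)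

data Allowed : Piece → Dir → Set where
  king-any : ∀ {c d} → Allowed (c , king) d
  black-NE : Allowed (black , pawn) NE
  black-NW : Allowed (black , pawn) NW
  white-SE : Allowed (white , pawn) SE
  white-SW : Allowed (white , pawn) SW

_≟ˢ_ : (s t : Square) → Relation.Nullary.Dec (s ≡ t)
_≟ˢ_ = ≡-dec ℤ._≟_ ℤ._≟_

set : Board → Square → Maybe Piece → Board
set b s m t with t ≟ˢ s
... | yes _ = m
... | no  _ = b t

data SimpleStep (c : Colour) (b : Board) : Board → Set where
  simple : ∀ s d k → b s ≡ just (c , k) → Allowed (c , k) d →
           b (step d s) ≡ nothing →
           SimpleStep c b (set (set b s nothing) (step d s) (just (c , k)))

data Jump (c : Colour) (b : Board) (s : Square) : Board → Square → Set where
  jump : ∀ d k k' → b s ≡ just (c , k) → Allowed (c , k) d →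
         b (step d s) ≡ just (opp c , k') →
         b (step d (step d s)) ≡ nothing →
         Jump c b s
           (set (set (set b s nothing) (step d s) nothing)
                (step d (step d s)) (just (c , k)))
           (step d (step d s))

data Jumps (c : Colour) : Board → Square → Board → Set where
  one  : ∀ {b s b' s'} → Jump c b s b' s' → Jumps c b s b'
  more : ∀ {b s b' s' b''} → Jump c b s b' s' → Jumps c b' s' b'' →
         Jumps c b s b''

JumpAvailable : Colour → Board → Set
JumpAvailable c b = Σ Square λ s → Σ Board λ b' → Σ Square λ s' → Jump c b s b' s'

data Move (st : State) : State → Set where
  jumpMove   : ∀ {s b'} → Jumps (toMove st) (board st) s b' →
               Move st ⟨ b' , opp (toMove st) ⟩
  simpleMove : ∀ {b'} → ¬ JumpAvailable (toMove st) (board st) →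
               SimpleStep (toMove st) (board st) b' →
               Move st ⟨ b' , opp (toMove st) ⟩

Stuck : State → Set
Stuck st = ∀ t → ¬ Move st t

-- every play through st is a win for O: every finite maximal play from
-- st ends with O's opponent to move and unable to move, and there is no
-- infinite play (draw) from st
AlreadyWon : Colour → State → Set
AlreadyWon O st =
  (∀ t → Star Move st t → Stuck t → toMove t ≡ opp O) ×
  ((f : ℕ → State) → f 0 ≡ st → (∀ n → Move (f n) (f (ℕ.suc n))) → ⊥)
  where import Data.Nat as ℕ

-- ValueAtMost O st α : st has a value (for O) and that value is ≤ α.
-- (The set of positions of value ≤ α, built by the clauses of the
-- recursive definition of game value.)
data ValueAtMost (O : Colour) : State → Ord → Set where
  won   : ∀ {st α} → AlreadyWon O st → ValueAtMost O st α
  omove : ∀ {st t β α} → toMove st ≡ O → Move st t → ValueAtMost O t β →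
          osuc β ≤ₒ α → ValueAtMost O st α
  cmove : ∀ {st α} → toMove st ≡ opp O →
          (∀ t → Move st t → ValueAtMost O t α) → ValueAtMost O st α

HasValue : Colour → State → Ord → Set
HasValue O st α = ValueAtMost O st α × (∀ β → ValueAtMost O st β → α ≤ₒ β)

{-# OPTIONS --safe #-}

-- White is the open player.  Every countable ordinal is the rank |t| = sup { |t′| + 1 : t′ a child
-- of t } of a countably branching well-founded tree t, and Black's moves descend such a tree.  All
-- pieces are pawns, the board is full of white ones apart from corridors (white pawn, hole, white
-- pawn, hole, …), and all moves are forced jumps.  Black chooses the child t′ by a single iterated
-- jump: his runner follows the infinite corridor of t and turns into the dead end belonging to t′.
-- If he stops elsewhere on the corridor, the white pawn in front of him jumps back over him and
-- Black, all of whose other pawns are blocked, cannot move: White has already won.  In the dead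
-- end White has two captures, from above and from the right.  Each vacates a gate through which a
-- blocked black pawn can jump: the first into the corridor of t′, the second into a corridor of
-- the tree in which every node has children forever, where the play need never end.  The second
-- capture is a blunder; its role is that White has not already won as long as a child remains.
--
-- Corridors cannot cross, so the tree of all corridors is drawn in the plane on the lattice ℕ × ℕ,
-- every corridor going right or up.  At stage k + j one corridor sends off a new one, which is
-- inserted directly above it, while the corridors further up make room by moving up.
module Submission where

open import Defs
open import Data.Bool using (Bool; true; false; not; _∧_; if_then_else_; T)
open import Data.Empty using (⊥; ⊥-elim)
open import Data.Integer using (+_; -[1+_]; 1ℤ; -1ℤ)
import Data.Integer.Properties as ℤ
open import Data.List using (List; []; _∷_)
open import Data.List.Relation.Unary.All using (All; []; _∷_)
open import Data.Maybe as Maybe using (Maybe; just; nothing; is-just; fromMaybe)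
open import Data.Maybe.Properties using (just-injective)
open import Data.Nat as ℕ using (ℕ; zero; suc; _+_; _*_; _∸_; _/_; _%_; _<_; _≤_; _<ᵇ_; _≡ᵇ_; s≤s)
open import Data.Nat.Divisibility using (n∣m*n)
open import Data.Nat.DivMod using (+-distrib-/-∣ʳ; m<n⇒m/n≡0; m*n/n≡m; [m+kn]%n≡m%n; m<n⇒m%n≡m; m≡m%n+[m/n]*n; m%n<n)
import Data.Nat.Properties as ℕ
open import Data.Product using (Σ; ∃; _×_; _,_; proj₁; proj₂)
open import Data.Sum using (_⊎_; inj₁; inj₂)
open import Data.Unit using (⊤; tt)
open import Function using (_∘_)
open import Relation.Binary.Construct.Closure.ReflexiveTransitive using (Star) renaming (ε to done; _◅_ to _then_)
open import Relation.Binary.PropositionalEquality using (_≡_; _≢_; refl; sym; trans; cong; cong₂; subst; subst₂)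
open import Relation.Nullary using (¬_; yes; no)

-- The order of ordinals and the monotonicity of values.

≤ₒ-refl : ∀ α → α ≤ₒ α
≤ₒ-refl ozero    = ≤-zero
≤ₒ-refl (osuc α) = ≤-suc (≤ₒ-refl α)
≤ₒ-refl (olim f) = ≤-limˡ λ n → ≤-limʳ n (≤ₒ-refl (f n))

≤ₒ-trans : ∀ {α β γ} → α ≤ₒ β → β ≤ₒ γ → α ≤ₒ γ
≤ₒ-trans ≤-zero       q            = ≤-zero
≤ₒ-trans (≤-limˡ p)   q            = ≤-limˡ λ n → ≤ₒ-trans (p n) q
≤ₒ-trans (≤-suc p)    (≤-suc q)    = ≤-suc (≤ₒ-trans p q)
≤ₒ-trans (≤-suc p)    (≤-limʳ n q) = ≤-limʳ n (≤ₒ-trans (≤-suc p) q)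
≤ₒ-trans (≤-limʳ n p) (≤-limˡ q)   = ≤ₒ-trans p (q n)
≤ₒ-trans (≤-limʳ n p) (≤-limʳ m q) = ≤-limʳ m (≤ₒ-trans (≤-limʳ n p) q)

ValueAtMost-mono : ∀ {O st α β} → ValueAtMost O st α → α ≤ₒ β → ValueAtMost O st β
ValueAtMost-mono (won w)         _   = won w
ValueAtMost-mono (omove o m v l) α≤β = omove o m v (≤ₒ-trans l α≤β)
ValueAtMost-mono (cmove c f)     α≤β = cmove c λ t m → ValueAtMost-mono (f t m) α≤β

HasValue-resp-≈ : ∀ {O st α β} → α ≈ₒ β → HasValue O st α → HasValue O st β
HasValue-resp-≈ (α≤β , β≤α) (v , least) =
  ValueAtMost-mono v α≤β , λ γ w → ≤ₒ-trans β≤α (least γ w)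

-- Trees of prescribed rank.

next : ℕ × ℕ → ℕ × ℕ
next (zero  , m) = suc m , zero
next (suc i , m) = i , suc m

-- The enumeration of all pairs along the antidiagonals, each of them from `(s , 0)` to `(0 , s)`.
unpair : ℕ → ℕ × ℕ
unpair zero    = zero , zero
unpair (suc n) = next (unpair n)

unpair-surjective : ∀ i m → ∃ λ n → unpair n ≡ (i , m)
unpair-surjective i m = go (i ℕ.+ m) i m refl
  where
  go : ∀ s i m → i ℕ.+ m ≡ s → ∃ λ n → unpair n ≡ (i , m)
  go s       i       (suc m) e with go s (suc i) m (trans (sym (ℕ.+-suc i m)) e)
  ... | n , p = suc n , cong next p
  go s       zero    zero    e = zero , refl
  go (suc s) (suc i) zero    e with go s zero i (trans (sym (ℕ.+-identityʳ i)) (ℕ.suc-injective e))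
  ... | n , p = suc n , cong next p

data Tree : Set where
  node : (ℕ → Maybe Tree) → Tree

mutual
  ∣_∣ : Tree → Ord
  ∣ node h ∣ = olim λ n → ∣ h n ∣⁺

  ∣_∣⁺ : Maybe Tree → Ord
  ∣ nothing ∣⁺ = ozero
  ∣ just t  ∣⁺ = osuc ∣ t ∣

branch : Tree → ℕ → Maybe Tree
branch (node h) = h

-- At a limit the children of all the trees `tree (f i)` are merged under one root. Taking these
-- trees themselves as children would give the supremum of the `f i + 1`, which can be too large.
tree : Ord → Tree
tree ozero    = node λ _ → nothing
tree (osuc α) = node λ _ → just (tree α)
tree (olim f) = node λ n → branch (tree (f (proj₁ (unpair n)))) (proj₂ (unpair n))

branch-≤ : ∀ t n → ∣ branch t n ∣⁺ ≤ₒ ∣ t ∣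
branch-≤ (node h) n = ≤-limʳ n (≤ₒ-refl _)

∣∣-least : ∀ t {β} → (∀ n → ∣ branch t n ∣⁺ ≤ₒ β) → ∣ t ∣ ≤ₒ β
∣∣-least (node h) p = ≤-limˡ p

∣tree∣≈ : ∀ α → ∣ tree α ∣ ≈ₒ α
∣tree∣≈ ozero    = ≤-limˡ (λ _ → ≤-zero) , ≤-zero
∣tree∣≈ (osuc α) with ∣tree∣≈ α
... | l , g = ≤-limˡ (λ _ → ≤-suc l) , ≤-limʳ 0 (≤-suc g)
∣tree∣≈ (olim f) =
  ≤-limˡ (λ n → ≤-limʳ (proj₁ (unpair n))
    (≤ₒ-trans (branch-≤ (tree (f _)) _) (proj₁ (∣tree∣≈ (f _))))) ,
  ≤-limˡ λ i → ≤ₒ-trans (proj₂ (∣tree∣≈ (f i)))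
    (∣∣-least (tree (f i)) λ m → at i m (unpair-surjective i m))
  where
  at : ∀ i m → (∃ λ n → unpair n ≡ (i , m)) → ∣ branch (tree (f i)) m ∣⁺ ≤ₒ ∣ tree (olim f) ∣
  at i m (n , refl) = ≤-limʳ n (≤ₒ-refl _)

-- The layout of the corridors

-- What the corridor through the lattice point (k , j) does when the clock shows r = time k j: it is
-- pushed up if ⌊ r / 2 ⌋ < j, and otherwise goes right.  If j = ⌊ r / 2 ⌋ it forks (r odd); in the
-- next cell (r even) the corridor for White's blunder at that fork arrives beside it and turns up.
data Shape : Set where
  straight upward fork join : Shape

shape : ℕ → ℕ → Shape
shape zero    zero          = join
shape zero    (suc zero)    = fork
shape zero    (suc (suc r)) = straight
shape (suc j) zero          = upward
shape (suc j) (suc zero)    = upward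
shape (suc j) (suc (suc r)) = shape j r

double : ℕ → ℕ
double zero    = zero
double (suc n) = suc (suc (double n))

-- The clock runs down to 0 and then restarts above every corridor present, so that each of them
-- forks infinitely often.
tick : ℕ → ℕ → ℕ
tick l zero    = 3 + double l
tick l (suc r) = r

-- All points of the antidiagonal `k + j = l` show the reading `clock l`. Row `j` forks at the
-- reading `1 + 2 j`, so the restart value `3 + double l` is the fork reading of row `suc l`, the
-- top of the next antidiagonal.
clock : ℕ → ℕ
-- The reading 1 makes `(0 , 0)` a fork, the one from which the game starts.
clock zero    = 1
clock (suc l) = tick l (clock l)

-- time k j = clock (k + j), arranged so that time k (suc j) and time (suc k) j are convertible.
time : ℕ → ℕ → ℕ
time k zero    = clock k
time k (suc j) = time (suc k) j

time-suc : ∀ k j → time (suc k) j ≡ tick (k + j) (time k j)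
time-suc k zero    = cong (λ l → tick l (clock k)) (sym (ℕ.+-identityʳ k))
time-suc k (suc j) =
  trans (time-suc (suc k) j) (cong (λ l → tick l (time (suc k) j)) (sym (ℕ.+-suc k j)))

-- fin h offers the children h 0, h 1, … in this order at its forks; inf always offers inf.  The
-- Booleans ε and δ (ε = false for fin) are the parities of the columns and rows of its holes: a jump
-- preserves them, while unlocking a new runner flips one of them.
data Lane : Set where
  fin : (ℕ → Maybe Tree) → Bool → Lane
  inf : Bool → Bool → Lane

eps del : Lane → Bool
eps (fin _ _) = false
eps (inf ε _) = ε
del (fin _ δ) = δ
del (inf _ δ) = δ

grow : Bool → Tree → Lane
grow δ t = fin (branch t) δ

nth : Lane → ℕ → Maybe Lane
nth (fin h δ) n = Maybe.map (grow (not δ)) (h n)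
nth (inf ε δ) n = just (inf ε (not δ))

tail : Lane → Lane
tail (fin h δ) = fin (h ∘ suc) δ
tail (inf ε δ) = inf ε δ

draw : Lane → Lane
draw L = inf (not (eps L)) (del L)

goʳ goᵘ : Shape → Lane → Lane
goʳ fork L = tail L
goʳ _    L = L
-- If the child is missing, the default is a corridor without children; `drawn` then shows the fork
-- as a straight cell, so no turning leads into it.
goᵘ fork L = fromMaybe (fin (λ _ → nothing) (not (del L))) (nth L 0)
goᵘ join L = draw L
goᵘ _    L = L

-- The role of a square in the initial position.  White pawns: hard ones stay forever, hard₂
-- ones until a blunder; a bar and a gate block the pawn idle₁; soft ones may be jumped over or may
-- capture.  Black pawns: idle₁ and idle₂ become runners; idleˡ and idleʳ protect idle₂, whose left
-- neighbour is a hole.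
data Lab : Set where
  empty soft hard hard₂ bar gate idle₁ idle₂ idleˡ idleʳ : Lab

code : Lab → ℕ
code empty = 0
code soft  = 1
code hard  = 2
code hard₂ = 3
code bar   = 4
code gate  = 5
code idle₁ = 6
code idle₂ = 7
code idleˡ = 8
code idleʳ = 9

decode : ℕ → Lab
decode 0 = empty
decode 1 = soft
decode 2 = hard
decode 3 = hard₂
decode 4 = bar
decode 5 = gate
decode 6 = idle₁
decode 7 = idle₂
decode 8 = idleˡ
decode _ = idleʳ

decode-code : ∀ l → decode (code l) ≡ l
decode-code empty = refl
decode-code soft  = refl
decode-code hard  = refl
decode-code hard₂ = refl
decode-code bar   = refl
decode-code gate  = refl
decode-code idle₁ = refl
decode-code idle₂ = refl
decode-code idleˡ = refl
decode-code idleʳ = refl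

_==_ : Lab → Lab → Bool
l == m = code l ≡ᵇ code m

==-sound : ∀ l m → T (l == m) → l ≡ m
==-sound l m t = trans (sym (decode-code l)) (trans (cong decode (ℕ.≡ᵇ⇒≡ _ _ t)) (decode-code m))

record Cell : Set where
  constructor cell
  field
    inˡ : Bool
    shp : Shape
    ε δ : Bool

-- A cell has 10 columns and 12 rows.  In the following tables the column and row numbers are shifted
-- by the parities ε and δ, so that the corridor of the cell always passes through (4 , 0).
row : Bool → Shape → ℕ → Lab
row i s 0  = if i then empty else soft
row i s 2  = if i then empty else soft
row i s 4  = empty
row i upward 6  = soft
row i upward 8  = soft
row i upward 10 = soft
row i s 6  = empty
row i s 8  = empty
row i s 10 = empty
row i s _  = soft

upL : ℕ → ℕ → Lab
upL 4 2  = empty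
upL 4 4  = empty
upL 4 6  = empty
upL 4 8  = empty
upL 4 10 = empty
upL _ _  = soft

joinL : Bool → ℕ → ℕ → Lab
joinL _     1 8  = empty
joinL _     3 8  = empty
joinL false 5 8  = empty
joinL false 5 10 = empty
joinL true  3 10 = empty
joinL _     _ _  = soft

-- The dead end is (4 , 6); it is reached upwards from (4 , 0).  White captures it from (4 , 7) into
-- (4 , 5), which lets idle₁ jump to (4 , 7) and go up, or from (5 , 6) into (3 , 6), which lets idle₂
-- jump to (5 , 6) and go round through (5 , 8), (7 , 8), … into the cell on the right.
forkL : ℕ → ℕ → Lab
forkL 4 2  = empty
forkL 4 4  = empty
forkL 4 6  = empty
forkL 3 6  = empty
forkL 5 6  = hard₂
forkL 5 5  = hard₂
forkL 5 4  = idle₂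
forkL 6 4  = idleˡ
forkL 7 4  = idleʳ
forkL 4 7  = gate
forkL 3 7  = bar
forkL 2 7  = idle₁
forkL 1 7  = hard
forkL 2 6  = hard
forkL 2 8  = hard
forkL 2 9  = hard
forkL 5 3  = hard
forkL 6 5  = hard
forkL 6 6  = hard
forkL 6 3  = hard
forkL 8 4  = hard
forkL 9 4  = hard
forkL 7 5  = hard
forkL 7 6  = hard
forkL 7 3  = hard
forkL 4 9  = empty
forkL 4 11 = empty
forkL 5 8  = empty
forkL 7 8  = empty
forkL 9 8  = empty
forkL _ _  = soft

area : Bool → Shape → Bool → ℕ → ℕ → Lab
area i s        ε a zero      = row i s a
area i straight ε a b@(suc _) = soft
area i upward   ε a b@(suc _) = upL a b
area i join     ε a b@(suc _) = joinL ε a b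
area i fork     ε a b@(suc _) = forkL a b

pat : Cell → ℕ → ℕ → Lab
pat (cell i s false false) u v       = area i s false (suc u) v
pat (cell i s true  false) u v       = area i s true  u v
pat (cell i s ε     true)  u zero    = soft
pat (cell i s false true)  u (suc b) = area i s false (suc u) b
pat (cell i s true  true)  u (suc b) = area i s true  u b

-- Directions, and the check of the surroundings of idle pawns.

data Way : Set where
  rt up : Way

other : Way → Way
other rt = up
other up = rt

gx gy : Way → ℕ → ℕ
gx rt x = suc x
gx up x = x
gy rt y = y
gy up y = suc y

data Off : Set where
  east east² north north² west south : Off

off : Off → Square → Square
off east   p = step NE p
off east²  p = step NE (step NE p)
off north  p = step NW p
off north² p = step NW (step NW p)
off west   p = step SW p
off south  p = step SE p

-- Exactly the neighbours that keep an idle pawn from moving and from being captured.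
spec : Lab → List (Off × Lab)
spec idle₁ = (east , bar) ∷ (east² , gate) ∷ (north , hard) ∷ (north² , hard) ∷
             (west , hard) ∷ (south , hard) ∷ []
spec idle₂ = (east , idleˡ) ∷ (north , hard₂) ∷ (north² , hard₂) ∷ (south , hard) ∷ []
spec idleˡ = (east , idleʳ) ∷ (north , hard) ∷ (north² , hard) ∷ (south , hard) ∷ []
spec idleʳ = (east , hard) ∷ (east² , hard) ∷ (north , hard) ∷ (north² , hard) ∷
             (west , idleˡ) ∷ (south , hard) ∷ []
spec _     = []

shift : Off → ℕ → ℕ → Maybe (ℕ × ℕ)
shift east   u       v       = just (1 + u , v)
shift east²  u       v       = just (2 + u , v)
shift north  u       v       = just (u , 1 + v)
shift north² u       v       = just (u , 2 + v)
shift west   zero    v       = nothing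
shift west   (suc u) v       = just (u , v)
shift south  u       zero    = nothing
shift south  u       (suc v) = just (u , v)

inside : ℕ → ℕ → Bool
inside u v = (u <ᵇ 10) ∧ (v <ᵇ 12)

holds : Cell → Maybe (ℕ × ℕ) → Lab → Bool
holds c nothing        l = false
holds c (just (u , v)) l = inside u v ∧ (pat c u v == l)

allHold : Cell → ℕ → ℕ → List (Off × Lab) → Bool
allHold c u v []             = true
allHold c u v ((o , l) ∷ xs) = holds c (shift o u v) l ∧ allHold c u v xs

allBelow : ℕ → (ℕ → Bool) → Bool
allBelow zero    f = true
allBelow (suc n) f = f n ∧ allBelow n f

∧-T : ∀ {a b} → T (a ∧ b) → T a × T b
∧-T {true} {true} _ = tt , tt

allBelow-sound : ∀ n f → T (allBelow n f) → ∀ {i} → i < n → T (f i)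
allBelow-sound (suc n) f t {i} (s≤s i≤n) with ∧-T {f n} t | i ℕ.≟ n
... | p , _ | yes refl = p
... | _ , q | no i≢n   = allBelow-sound n f q (ℕ.≤∧≢⇒< i≤n i≢n)

-- The neighbours required by `spec` all lie in the cell of the idle pawn, so the property depends
-- on the kind of cell alone, and evaluating the 32 kinds proves it for the whole board.
surroundings : Cell → Bool
surroundings c = allBelow 10 λ u → allBelow 12 λ v → allHold c u v (spec (pat c u v))

surroundings-ok : ∀ c → T (surroundings c)
surroundings-ok (cell false straight false false) = tt
surroundings-ok (cell false straight false true)  = tt
surroundings-ok (cell false straight true  false) = tt
surroundings-ok (cell false straight true  true)  = tt
surroundings-ok (cell false upward   false false) = tt
surroundings-ok (cell false upward   false true)  = tt
surroundings-ok (cell false upward   true  false) = tt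
surroundings-ok (cell false upward   true  true)  = tt
surroundings-ok (cell false fork     false false) = tt
surroundings-ok (cell false fork     false true)  = tt
surroundings-ok (cell false fork     true  false) = tt
surroundings-ok (cell false fork     true  true)  = tt
surroundings-ok (cell false join     false false) = tt
surroundings-ok (cell false join     false true)  = tt
surroundings-ok (cell false join     true  false) = tt
surroundings-ok (cell false join     true  true)  = tt
surroundings-ok (cell true  straight false false) = tt
surroundings-ok (cell true  straight false true)  = tt
surroundings-ok (cell true  straight true  false) = tt
surroundings-ok (cell true  straight true  true)  = tt
surroundings-ok (cell true  upward   false false) = tt
surroundings-ok (cell true  upward   false true)  = tt
surroundings-ok (cell true  upward   true  false) = tt
surroundings-ok (cell true  upward   true  true)  = tt
surroundings-ok (cell true  fork     false false) = tt
surroundings-ok (cell true  fork     false true)  = tt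
surroundings-ok (cell true  fork     true  false) = tt
surroundings-ok (cell true  fork     true  true)  = tt
surroundings-ok (cell true  join     false false) = tt
surroundings-ok (cell true  join     false true)  = tt
surroundings-ok (cell true  join     true  false) = tt
surroundings-ok (cell true  join     true  true)  = tt

surroundings-at : ∀ c {u v} → u < 10 → v < 12 → T (allHold c u v (spec (pat c u v)))
surroundings-at c {u} {v} u<10 v<12 =
  allBelow-sound 12 (λ v → allHold c u v (spec (pat c u v)))
    (allBelow-sound 10 (λ u → allBelow 12 λ v → allHold c u v (spec (pat c u v))) (surroundings-ok c) u<10)
    v<12

-- The corridors on the lattice ℕ × ℕ.

module Arena (root : Tree) where

  pick : Shape → Lane → Lane → Lane
  pick straight l c = l
  pick s        l c = goᵘ s c

  content : ℕ → ℕ → Lane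
  -- An auxiliary corridor, whose fork in the first cell leads to the corridor of `root`.
  content zero    zero    = fin (λ _ → just root) false
  content zero    (suc j) = goᵘ (shape j (time 0 j)) (content 0 j)
  content (suc k) zero    = goʳ (shape 0 (time k 0)) (content k 0)
  content (suc k) (suc j) =
    pick (shape j (time (suc k) j)) (goʳ (shape (suc j) (time k (suc j))) (content k (suc j)))
         (content (suc k) j)

  isStraight : Shape → Bool
  isStraight straight = true
  isStraight _        = false

  fromLeft : ℕ → ℕ → Bool
  fromLeft zero    _       = false
  fromLeft (suc k) zero    = true
  fromLeft (suc k) (suc j) = isStraight (shape j (time (suc k) j))

  drawn : Shape → Lane → Shape
  drawn fork L = if is-just (nth L 0) then fork else straight
  drawn s    L = s

  shapeAt : ℕ → ℕ → Shape
  shapeAt k j = shape j (time k j)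

  cellAt : ℕ → ℕ → Cell
  cellAt k j =
    cell (fromLeft k j) (drawn (shapeAt k j) (content k j)) (eps (content k j)) (del (content k j))

  -- The two shapes belong to `(k , suc j)` and `(suc k , j)`, which show the same reading and both
  -- border on `(suc k , suc j)`. If the first sends its corridor right, the second sends none up,
  -- so `pick` never has to choose between two corridors.
  shape-suc : ∀ j r → shape (suc j) r ≢ upward → shape j r ≡ straight
  shape-suc j       zero          ¬u = ⊥-elim (¬u refl)
  shape-suc j       (suc zero)    ¬u = ⊥-elim (¬u refl)
  shape-suc zero    (suc (suc r)) ¬u = refl
  shape-suc (suc j) (suc (suc r)) ¬u = shape-suc j r ¬u

  content-rt : ∀ k j → shapeAt k j ≢ upward →
               fromLeft (suc k) j ≡ true × content (suc k) j ≡ goʳ (shapeAt k j) (content k j)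
  content-rt k zero    _  = refl , refl
  content-rt k (suc j) ¬u rewrite shape-suc j (time (suc k) j) ¬u = refl , refl

  content-up : ∀ k j → shapeAt k j ≢ straight → content k (suc j) ≡ goᵘ (shapeAt k j) (content k j)
  content-up zero    j _  = refl
  content-up (suc k) j ¬s with shape j (time (suc k) j)
  ... | straight = ⊥-elim (¬s refl)
  ... | upward   = refl
  ... | fork     = refl
  ... | join     = refl

  -- The labels of the squares, computed cell by cell.

  sq : ℕ → ℕ → Square
  sq x y = + x , + y

  split-/ : ∀ u k n .{{_ : ℕ.NonZero n}} → u < n → (u + k * n) / n ≡ k
  split-/ u k n u<n = trans (+-distrib-/-∣ʳ u (n∣m*n k)) (cong₂ _+_ (m<n⇒m/n≡0 u<n) (m*n/n≡m k n))

  split-% : ∀ u k n .{{_ : ℕ.NonZero n}} → u < n → (u + k * n) % n ≡ u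
  split-% u k n u<n = trans ([m+kn]%n≡m%n u k n) (m<n⇒m%n≡m u<n)

  abstract

    lab : Square → Lab
    lab (+ x      , + y)      = pat (cellAt (x / 10) (y / 12)) (x % 10) (y % 12)
    lab (+ _      , -[1+ _ ]) = soft
    lab (-[1+ _ ] , _)        = soft

    lab-sq : ∀ x y → lab (sq x y) ≡ pat (cellAt (x / 10) (y / 12)) (x % 10) (y % 12)
    lab-sq x y = refl

    lab-on : ∀ p → lab p ≢ soft → ∃ λ x → ∃ λ y → p ≡ sq x y
    lab-on (+ x      , + y)      n = x , y , refl
    lab-on (+ _      , -[1+ _ ]) n = ⊥-elim (n refl)
    lab-on (-[1+ _ ] , _)        n = ⊥-elim (n refl)

  lab-at : ∀ k j {u v} → u < 10 → v < 12 →
           lab (sq (u + k * 10) (v + j * 12)) ≡ pat (cellAt k j) u v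
  lab-at k j {u} {v} u<10 v<12 = trans (lab-sq (u + k * 10) (v + j * 12)) (cong-pat
    (split-/ u k 10 u<10) (split-/ v j 12 v<12) (split-% u k 10 u<10) (split-% v j 12 v<12))
    where
    cong-pat : ∀ {k k′ j j′ u u′ v v′} → k ≡ k′ → j ≡ j′ → u ≡ u′ → v ≡ v′ →
               pat (cellAt k j) u v ≡ pat (cellAt k′ j′) u′ v′
    cong-pat refl refl refl refl = refl

  inside-sound : ∀ u v → T (inside u v) → u < 10 × v < 12
  inside-sound u v t with ∧-T {u <ᵇ 10} t
  ... | p , q = ℕ.<ᵇ⇒< u 10 p , ℕ.<ᵇ⇒< v 12 q

  off-at : ∀ o {u v u′ v′} → shift o u v ≡ just (u′ , v′) → ∀ K J →
           off o (sq (u + K) (v + J)) ≡ sq (u′ + K) (v′ + J)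
  off-at east refl K J = cong₂ sq (ℕ.+-comm _ 1) refl
  off-at east² {u} refl K J = cong₂ sq (trans (ℕ.+-assoc (u + K) 1 1) (ℕ.+-comm _ 2)) refl
  off-at north refl K J = cong₂ sq refl (ℕ.+-comm _ 1)
  off-at north² {v = v} refl K J = cong₂ sq refl (trans (ℕ.+-assoc (v + J) 1 1) (ℕ.+-comm _ 2))
  off-at west {suc u} refl K J = refl
  off-at south {u} {suc v} refl K J = refl

  holds-sound : ∀ o k j u v l → T (holds (cellAt k j) (shift o u v) l) →
                lab (off o (sq (u + k * 10) (v + j * 12))) ≡ l
  holds-sound o k j u v l t with shift o u v in e
  ... | just (u′ , v′) with ∧-T {inside u′ v′} t
  ... | i , h with inside-sound u′ v′ i
  ... | u<10 , v<12 =
    trans (cong lab (off-at o e (k * 10) (j * 12)))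
          (trans (lab-at k j u<10 v<12) (==-sound _ l h))

  allHold-sound : ∀ k j u v xs → T (allHold (cellAt k j) u v xs) →
                  All (λ { (o , l) → lab (off o (sq (u + k * 10) (v + j * 12))) ≡ l }) xs
  allHold-sound k j u v []             _ = []
  allHold-sound k j u v ((o , l) ∷ xs) t with ∧-T {holds (cellAt k j) (shift o u v) l} t
  ... | p , q = holds-sound o k j u v l p ∷ allHold-sound k j u v xs q

  around : ∀ {p l} → l ≢ soft → lab p ≡ l → All (λ { (o , l) → lab (off o p) ≡ l }) (spec l)
  around {p} {l} l≢soft eq with lab-on p (λ e → l≢soft (trans (sym eq) e))
  ... | x , y , refl =
    subst₂ (λ x′ y′ → All (λ { (o , l) → lab (off o (sq x′ y′)) ≡ l }) (spec l))
      (sym (m≡m%n+[m/n]*n x 10)) (sym (m≡m%n+[m/n]*n y 12))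
      (allHold-sound (x / 10) (y / 12) (x % 10) (y % 12) (spec l)
        (subst (T ∘ allHold (cellAt (x / 10) (y / 12)) (x % 10) (y % 12) ∘ spec)
          (trans (sym (lab-sq x y)) eq)
          (surroundings-at (cellAt (x / 10) (y / 12)) (m%n<n x 10) (m%n<n y 12))))

  -- Paths through corridors and their verification on blocks of cells.

  bit : Bool → ℕ
  bit false = 0
  bit true  = 1

  Free : List Way → ℕ → ℕ → Set
  Free []       x y = ⊤
  Free (w ∷ ds) x y =
    lab (sq (gx w x) (gy w y)) ≡ soft ×
    lab (sq (gx w (gx w x)) (gy w (gy w y))) ≡ empty ×
    Free ds (gx w (gx w x)) (gy w (gy w y))

  -- Wherever White captures a runner on a calm hole, no idle pawn is unblocked.
  Calm : ℕ → ℕ → Set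
  Calm x y = lab (sq (suc x) y) ≡ soft × lab (sq x (suc y)) ≡ soft

  -- `Free` lets the runner follow `ds`; `Track` also confines him to it, as the landing square in
  -- the other direction is never a hole. The lower bound exhibits jumps of Black and needs the
  -- former; the upper bound has to control all of them and needs the latter.
  Track : List Way → ℕ → ℕ → Set
  Track []       x y = ⊤
  Track (w ∷ ds) x y =
    Calm x y ×
    lab (sq (gx w (gx w x)) (gy w (gy w y))) ≡ empty ×
    lab (sq (gx (other w) (gx (other w) x)) (gy (other w) (gy (other w) y))) ≢ empty ×
    Track ds (gx w (gx w x)) (gy w (gy w y))

  walkˣ walkʸ : List Way → ℕ → ℕ
  walkˣ []       x = x
  walkˣ (w ∷ ds) x = walkˣ ds (gx w (gx w x))
  walkʸ []       y = y
  walkʸ (w ∷ ds) y = walkʸ ds (gy w (gy w y))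

  record ForkLabels (x y : ℕ) : Set where
    field
      labQ₁    : lab (sq (1 + x) (7 + y)) ≡ idle₁
      labBar₁  : lab (sq (2 + x) (7 + y)) ≡ bar
      labGate₁ : lab (sq (3 + x) (7 + y)) ≡ gate
      labSlot  : lab (sq (2 + x) (6 + y)) ≡ empty
      labEnd   : lab (sq (3 + x) (6 + y)) ≡ empty
      labGate₂ : lab (sq (4 + x) (6 + y)) ≡ hard₂
      labBar₂  : lab (sq (4 + x) (5 + y)) ≡ hard₂
      labQ₂    : lab (sq (4 + x) (4 + y)) ≡ idle₂

  -- A path may leave its cell to the right or upwards, so it is checked in a window of two by two
  -- cells, each given by its kind. Cells that the path does not touch can stay variables in the
  -- computation.
  record Block (k j : ℕ) (c₀₀ c₁₀ c₀₁ c₁₁ : Cell) : Set where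
    constructor block
    field
      eq₀₀ : cellAt k j ≡ c₀₀
      eq₁₀ : cellAt (suc k) j ≡ c₁₀
      eq₀₁ : cellAt k (suc j) ≡ c₀₁
      eq₁₁ : cellAt (suc k) (suc j) ≡ c₁₁

  view : Cell → Cell → Cell → Cell → ℕ → ℕ → Lab
  view c₀₀ c₁₀ c₀₁ c₁₁ u v =
    if u <ᵇ 10 then (if v <ᵇ 12 then pat c₀₀ u v else pat c₀₁ u (v ∸ 12))
               else (if v <ᵇ 12 then pat c₁₀ (u ∸ 10) v else pat c₁₁ (u ∸ 10) (v ∸ 12))

  inBlock : ℕ → ℕ → Bool
  inBlock u v = (u <ᵇ 20) ∧ (v <ᵇ 24)

  ∸-< : ∀ m n {u} → u < m + n → ¬ u < m → u ∸ m < n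
  ∸-< m n {u} lt ¬lt = ℕ.≤-trans (ℕ.≤-reflexive (sym (ℕ.+-∸-assoc 1 (ℕ.≮⇒≥ ¬lt))))
    (ℕ.≤-trans (ℕ.∸-monoˡ-≤ m lt) (ℕ.≤-reflexive (ℕ.m+n∸m≡n m n)))

  carry : ∀ m k {u} → ¬ u < m → u + k * m ≡ (u ∸ m) + suc k * m
  carry m k {u} ¬lt = trans (cong (_+ k * m) (sym (ℕ.m∸n+n≡m (ℕ.≮⇒≥ ¬lt)))) (ℕ.+-assoc (u ∸ m) m (k * m))

  data Below (u m : ℕ) : Bool → Set where
    below  : u < m   → Below u m true
    beyond : ¬ u < m → Below u m false

  compare-below : ∀ u m → Below u m (u <ᵇ m)
  compare-below u m with u <ᵇ m in e
  ... | true  = below (ℕ.<ᵇ⇒< u m (subst T (sym e) tt))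
  ... | false = beyond λ lt → subst T e (ℕ.<⇒<ᵇ lt)

  view-sound : ∀ {k j c₀₀ c₁₀ c₀₁ c₁₁} → Block k j c₀₀ c₁₀ c₀₁ c₁₁ → ∀ u v → T (inBlock u v) →
               lab (sq (u + k * 10) (v + j * 12)) ≡ view c₀₀ c₁₀ c₀₁ c₁₁ u v
  view-sound {k} {j} (block refl refl refl refl) u v t with ∧-T {u <ᵇ 20} t
  ... | p , q with u <ᵇ 10 | compare-below u 10 | v <ᵇ 12 | compare-below v 12
  ... | _ | below a  | _ | below b  = lab-at k j a b
  ... | _ | beyond a | _ | below b  =
    trans (cong (λ x → lab (sq x (v + j * 12))) (carry 10 k a))
          (lab-at (suc k) j (∸-< 10 10 (ℕ.<ᵇ⇒< u 20 p) a) b)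
  ... | _ | below a  | _ | beyond b =
    trans (cong (λ y → lab (sq (u + k * 10) y)) (carry 12 j b))
          (lab-at k (suc j) a (∸-< 12 12 (ℕ.<ᵇ⇒< v 24 q) b))
  ... | _ | beyond a | _ | beyond b =
    trans (cong₂ (λ x y → lab (sq x y)) (carry 10 k a) (carry 12 j b))
          (lab-at (suc k) (suc j) (∸-< 10 10 (ℕ.<ᵇ⇒< u 20 p) a) (∸-< 12 12 (ℕ.<ᵇ⇒< v 24 q) b))

  module Check (φ : ℕ → ℕ → Lab) where

    is : Lab → ℕ → ℕ → Bool
    is l u v = inBlock u v ∧ (φ u v == l)

    isn't : Lab → ℕ → ℕ → Bool
    isn't l u v = inBlock u v ∧ not (φ u v == l)

    free? : List Way → ℕ → ℕ → Bool
    free? []       u v = true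
    free? (w ∷ ds) u v =
      is soft (gx w u) (gy w v) ∧ is empty (gx w (gx w u)) (gy w (gy w v)) ∧
      free? ds (gx w (gx w u)) (gy w (gy w v))

    calm? : ℕ → ℕ → Bool
    calm? u v = is soft (suc u) v ∧ is soft u (suc v)

    track? : List Way → ℕ → ℕ → Bool
    track? []       u v = true
    track? (w ∷ ds) u v =
      calm? u v ∧ is empty (gx w (gx w u)) (gy w (gy w v)) ∧
      isn't empty (gx (other w) (gx (other w) u)) (gy (other w) (gy (other w) v)) ∧
      track? ds (gx w (gx w u)) (gy w (gy w v))

    fork? : ℕ → ℕ → Bool
    fork? u v =
      is idle₁ (1 + u) (7 + v) ∧ is bar (2 + u) (7 + v) ∧ is gate (3 + u) (7 + v) ∧
      is empty (2 + u) (6 + v) ∧ is empty (3 + u) (6 + v) ∧ is hard₂ (4 + u) (6 + v) ∧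
      is hard₂ (4 + u) (5 + v) ∧ is idle₂ (4 + u) (4 + v)

    module Sound (K J : ℕ)
      (φ-sound : ∀ u v → T (inBlock u v) → lab (sq (u + K) (v + J)) ≡ φ u v) where

      is-sound : ∀ l u v → T (is l u v) → lab (sq (u + K) (v + J)) ≡ l
      is-sound l u v t with ∧-T {inBlock u v} t
      ... | i , e = trans (φ-sound u v i) (==-sound _ l e)

      isn't-sound : ∀ l u v → T (isn't l u v) → lab (sq (u + K) (v + J)) ≢ l
      isn't-sound l u v t eq with ∧-T {inBlock u v} t
      ... | i , n with trans (sym eq) (φ-sound u v i)
      ... | refl = refute (code l) n
        where
        refute : ∀ m → T (not (m ≡ᵇ m)) → ⊥
        refute zero    ()
        refute (suc m) = refute m

      free-sound : ∀ ds u v → T (free? ds u v) → Free ds (u + K) (v + J)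
      free-sound []        u v t = tt
      free-sound (rt ∷ ds) u v t with ∧-T {is soft (suc u) v} t
      ... | a , t′ with ∧-T {is empty (suc (suc u)) v} t′
      ... | b , t″ = is-sound soft _ v a , is-sound empty _ v b , free-sound ds _ v t″
      free-sound (up ∷ ds) u v t with ∧-T {is soft u (suc v)} t
      ... | a , t′ with ∧-T {is empty u (suc (suc v))} t′
      ... | b , t″ = is-sound soft u _ a , is-sound empty u _ b , free-sound ds u _ t″

      calm-sound : ∀ u v → T (calm? u v) → Calm (u + K) (v + J)
      calm-sound u v t with ∧-T {is soft (suc u) v} t
      ... | a , b = is-sound soft _ v a , is-sound soft u _ b

      fork-sound : ∀ u v → T (fork? u v) → ForkLabels (u + K) (v + J)
      fork-sound u v t with ∧-T {is idle₁ (1 + u) (7 + v)} t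
      ... | a , t₁ with ∧-T {is bar (2 + u) (7 + v)} t₁
      ... | b , t₂ with ∧-T {is gate (3 + u) (7 + v)} t₂
      ... | c , t₃ with ∧-T {is empty (2 + u) (6 + v)} t₃
      ... | d , t₄ with ∧-T {is empty (3 + u) (6 + v)} t₄
      ... | e , t₅ with ∧-T {is hard₂ (4 + u) (6 + v)} t₅
      ... | f , t₆ with ∧-T {is hard₂ (4 + u) (5 + v)} t₆
      ... | g , h = record
        { labQ₁ = is-sound _ (1 + u) (7 + v) a ; labBar₁  = is-sound _ (2 + u) (7 + v) b
        ; labGate₁ = is-sound _ (3 + u) (7 + v) c ; labSlot = is-sound _ (2 + u) (6 + v) d
        ; labEnd = is-sound _ (3 + u) (6 + v) e ; labGate₂ = is-sound _ (4 + u) (6 + v) f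
        ; labBar₂ = is-sound _ (4 + u) (5 + v) g ; labQ₂ = is-sound _ (4 + u) (4 + v) h }

      track-sound : ∀ ds u v → T (track? ds u v) → Track ds (u + K) (v + J)
      track-sound []        u v t = tt
      track-sound (rt ∷ ds) u v t with ∧-T {calm? u v} t
      ... | c , t₁ with ∧-T {is empty (suc (suc u)) v} t₁
      ... | b , t₂ with ∧-T {isn't empty u (suc (suc v))} t₂
      ... | a , t₃ =
        calm-sound u v c , is-sound empty _ v b , isn't-sound empty u _ a , track-sound ds _ v t₃
      track-sound (up ∷ ds) u v t with ∧-T {calm? u v} t
      ... | c , t₁ with ∧-T {is empty u (suc (suc v))} t₁
      ... | b , t₂ with ∧-T {isn't empty (suc (suc u)) v} t₂
      ... | a , t₃ =
        calm-sound u v c , is-sound empty u _ b , isn't-sound empty _ v a , track-sound ds u _ t₃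

  open Check public using (free?; track?; calm?; fork?)

  module Blk {k j : ℕ} {c₀₀ c₁₀ c₀₁ c₁₁ : Cell} (blk : Block k j c₀₀ c₁₀ c₀₁ c₁₁) =
    Check.Sound (view c₀₀ c₁₀ c₀₁ c₁₁) (k * 10) (j * 12) (view-sound blk)

  -- The paths through each shape of cell.

  R⁴ R⁵ U³ U⁵ U⁶ : List Way
  R⁴ = rt ∷ rt ∷ rt ∷ rt ∷ []
  R⁵ = rt ∷ R⁴
  U³ = up ∷ up ∷ up ∷ []
  U⁵ = up ∷ up ∷ U³
  U⁶ = up ∷ U⁵

  climb : Bool → List Way
  climb false = U³
  climb true  = up ∷ up ∷ []

  detour : Bool → List Way
  detour false = up ∷ rt ∷ rt ∷ rt ∷ rt ∷ rt ∷ up ∷ up ∷ []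
  detour true  = up ∷ rt ∷ rt ∷ rt ∷ rt ∷ up ∷ up ∷ []

  orgˣ : Bool → ℕ
  orgˣ ε = 3 + bit ε

  module _ {k j : ℕ} {i : Bool} {t : Shape} {ε δ : Bool} where

    free-straight : ∀ {s c c′} → Block k j (cell i s ε δ) (cell true t ε δ) c c′ → s ≢ upward →
                    Free R⁵ (orgˣ ε + k * 10) (bit δ + j * 12)
    free-straight blk n = go _ ε δ blk n
      where
      go : ∀ s ε δ {c c′} → Block k j (cell i s ε δ) (cell true t ε δ) c c′ → s ≢ upward →
           Free R⁵ (orgˣ ε + k * 10) (bit δ + j * 12)
      go upward _ _ _ n = ⊥-elim (n refl)
      go straight false false blk _ = Blk.free-sound blk R⁵ 3 0 tt
      go straight false true  blk _ = Blk.free-sound blk R⁵ 3 1 tt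
      go straight true  false blk _ = Blk.free-sound blk R⁵ 4 0 tt
      go straight true  true  blk _ = Blk.free-sound blk R⁵ 4 1 tt
      go fork     false false blk _ = Blk.free-sound blk R⁵ 3 0 tt
      go fork     false true  blk _ = Blk.free-sound blk R⁵ 3 1 tt
      go fork     true  false blk _ = Blk.free-sound blk R⁵ 4 0 tt
      go fork     true  true  blk _ = Blk.free-sound blk R⁵ 4 1 tt
      go join     false false blk _ = Blk.free-sound blk R⁵ 3 0 tt
      go join     false true  blk _ = Blk.free-sound blk R⁵ 3 1 tt
      go join     true  false blk _ = Blk.free-sound blk R⁵ 4 0 tt
      go join     true  true  blk _ = Blk.free-sound blk R⁵ 4 1 tt

  module _ {k j : ℕ} {i i′ : Bool} {t : Shape} where

    free-upward : ∀ ε δ {c c′} → Block k j (cell i upward ε δ) c (cell i′ t ε δ) c′ →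
                  Free U⁶ (orgˣ ε + k * 10) (bit δ + j * 12)
    free-upward false false blk = Blk.free-sound blk U⁶ 3 0 tt
    free-upward false true  blk = Blk.free-sound blk U⁶ 3 1 tt
    free-upward true  false blk = Blk.free-sound blk U⁶ 4 0 tt
    free-upward true  true  blk = Blk.free-sound blk U⁶ 4 1 tt

    free-climb : ∀ ε δ {c c′} → Block k j (cell i fork ε δ) c (cell i′ t ε (not δ)) c′ →
                 Free (climb δ) (orgˣ ε + k * 10) (7 + bit δ + j * 12)
    free-climb false false blk = Blk.free-sound blk (climb false) 3 7 tt
    free-climb false true  blk = Blk.free-sound blk (climb true) 3 8 tt
    free-climb true  false blk = Blk.free-sound blk (climb false) 4 7 tt
    free-climb true  true  blk = Blk.free-sound blk (climb true) 4 8 tt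

    free-side : ∀ ε δ {c c′} → Block k j (cell i fork ε δ) c (cell i′ t ε (not δ)) c′ →
                Free U³ (orgˣ ε + k * 10) (bit δ + j * 12)
    free-side false false blk = Blk.free-sound blk U³ 3 0 tt
    free-side false true  blk = Blk.free-sound blk U³ 3 1 tt
    free-side true  false blk = Blk.free-sound blk U³ 4 0 tt
    free-side true  true  blk = Blk.free-sound blk U³ 4 1 tt

    fork-labels : ∀ ε δ {c c′} → Block k j (cell i fork ε δ) c (cell i′ t ε (not δ)) c′ →
                  ForkLabels (bit ε + k * 10) (bit δ + j * 12)
    fork-labels false false blk = Blk.fork-sound blk 0 0 tt
    fork-labels false true  blk = Blk.fork-sound blk 0 1 tt
    fork-labels true  false blk = Blk.fork-sound blk 1 0 tt
    fork-labels true  true  blk = Blk.fork-sound blk 1 1 tt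

  free-detour : ∀ {k j i i′ i″ t} ε δ {c} →
    Block k j (cell i fork ε δ) (cell i′ join ε δ) c (cell i″ t (not ε) δ) →
    Free (detour ε) (suc (orgˣ ε) + k * 10) (6 + bit δ + j * 12)
  free-detour false false blk = Blk.free-sound blk (detour false) 4 6 tt
  free-detour false true  blk = Blk.free-sound blk (detour false) 4 7 tt
  free-detour true  false blk = Blk.free-sound blk (detour true) 5 6 tt
  free-detour true  true  blk = Blk.free-sound blk (detour true) 5 7 tt

  -- Tracks are computed for ε = false, the parity of the corridors `fin`: the upper bound follows
  -- play without blunders, which never enters a corridor `inf`.
  track-straight : ∀ {k j i} t δ {c c′} →
    Block k j (cell i straight false δ) (cell true t false δ) c c′ → Track R⁵ (3 + k * 10) (bit δ + j * 12)
  track-straight straight false blk = Blk.track-sound blk R⁵ 3 0 tt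
  track-straight straight true  blk = Blk.track-sound blk R⁵ 3 1 tt
  track-straight upward   false blk = Blk.track-sound blk R⁵ 3 0 tt
  track-straight upward   true  blk = Blk.track-sound blk R⁵ 3 1 tt
  track-straight fork     false blk = Blk.track-sound blk R⁵ 3 0 tt
  track-straight fork     true  blk = Blk.track-sound blk R⁵ 3 1 tt
  track-straight join     false blk = Blk.track-sound blk R⁵ 3 0 tt
  track-straight join     true  blk = Blk.track-sound blk R⁵ 3 1 tt

  track-join : ∀ {k j i} t δ {c c′} →
    Block k j (cell i join false δ) (cell true t false δ) c c′ → Track R⁵ (3 + k * 10) (bit δ + j * 12)
  track-join straight false blk = Blk.track-sound blk R⁵ 3 0 tt
  track-join straight true  blk = Blk.track-sound blk R⁵ 3 1 tt
  track-join upward   false blk = Blk.track-sound blk R⁵ 3 0 tt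
  track-join upward   true  blk = Blk.track-sound blk R⁵ 3 1 tt
  track-join fork     false blk = Blk.track-sound blk R⁵ 3 0 tt
  track-join fork     true  blk = Blk.track-sound blk R⁵ 3 1 tt
  track-join join     false blk = Blk.track-sound blk R⁵ 3 0 tt
  track-join join     true  blk = Blk.track-sound blk R⁵ 3 1 tt

  -- The track starts one hole after the origin, since at the origin of a fork the runner may also
  -- turn up.
  track-fork : ∀ {k j i} t δ {c c′} →
    Block k j (cell i fork false δ) (cell true t false δ) c c′ → Track R⁴ (5 + k * 10) (bit δ + j * 12)
  track-fork straight false blk = Blk.track-sound blk R⁴ 5 0 tt
  track-fork straight true  blk = Blk.track-sound blk R⁴ 5 1 tt
  track-fork upward   false blk = Blk.track-sound blk R⁴ 5 0 tt
  track-fork upward   true  blk = Blk.track-sound blk R⁴ 5 1 tt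
  track-fork fork     false blk = Blk.track-sound blk R⁴ 5 0 tt
  track-fork fork     true  blk = Blk.track-sound blk R⁴ 5 1 tt
  track-fork join     false blk = Blk.track-sound blk R⁴ 5 0 tt
  track-fork join     true  blk = Blk.track-sound blk R⁴ 5 1 tt

  module _ {k j : ℕ} {i i′ : Bool} {t : Shape} where

    track-upward : ∀ δ {c c′} → Block k j (cell i upward false δ) c (cell i′ t false δ) c′ →
                   Track U⁶ (3 + k * 10) (bit δ + j * 12)
    track-upward false blk = Blk.track-sound blk U⁶ 3 0 tt
    track-upward true  blk = Blk.track-sound blk U⁶ 3 1 tt

    track-climb : ∀ δ {c c′} → Block k j (cell i fork false δ) c (cell i′ t false (not δ)) c′ →
                  Track (climb δ) (3 + k * 10) (7 + bit δ + j * 12)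
    track-climb false blk = Blk.track-sound blk (climb false) 3 7 tt
    track-climb true  blk = Blk.track-sound blk (climb true) 3 8 tt

  calm-origin : ∀ {k j i} s δ {c c′ c″} → Block k j (cell i s false δ) c c′ c″ →
                Calm (3 + k * 10) (bit δ + j * 12)
  calm-origin straight false blk = Blk.calm-sound blk 3 0 tt
  calm-origin straight true  blk = Blk.calm-sound blk 3 1 tt
  calm-origin upward   false blk = Blk.calm-sound blk 3 0 tt
  calm-origin upward   true  blk = Blk.calm-sound blk 3 1 tt
  calm-origin fork     false blk = Blk.calm-sound blk 3 0 tt
  calm-origin fork     true  blk = Blk.calm-sound blk 3 1 tt
  calm-origin join     false blk = Blk.calm-sound blk 3 0 tt
  calm-origin join     true  blk = Blk.calm-sound blk 3 1 tt

  -- These are the squares where a jump out of the side branch would land: to the right of each of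
  -- its three holes, and above the last one.
  record Walls (x y : ℕ) : Set where
    field
      wall₂ : lab (sq (5 + x) (2 + y)) ≢ empty
      wall₄ : lab (sq (5 + x) (4 + y)) ≢ empty
      wall₆ : lab (sq (5 + x) (6 + y)) ≢ empty
      roof  : lab (sq (3 + x) (8 + y)) ≢ empty

  walls : ∀ {k j i} δ {c c′ c″} → Block k j (cell i fork false δ) c c′ c″ → Walls (k * 10) (bit δ + j * 12)
  walls false blk = record
    { wall₂ = isn't-sound empty 5 2 tt ; wall₄ = isn't-sound empty 5 4 tt
    ; wall₆ = isn't-sound empty 5 6 tt ; roof  = isn't-sound empty 3 8 tt }
    where open Blk blk
  walls true blk = record
    { wall₂ = isn't-sound empty 5 3 tt ; wall₄ = isn't-sound empty 5 5 tt
    ; wall₆ = isn't-sound empty 5 7 tt ; roof  = isn't-sound empty 3 9 tt }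
    where open Blk blk

  -- The board and the effect of one jump.

  bp wp : Maybe Piece
  bp = just (black , pawn)
  wp = just (white , pawn)

  paint : Lab → Maybe Piece
  paint empty = nothing
  paint idle₁ = bp
  paint idle₂ = bp
  paint idleˡ = bp
  paint idleʳ = bp
  paint _     = wp

  B₀ : Board
  B₀ p = paint (lab p)

  dir back : Way → Dir
  dir rt  = NE
  dir up  = NW
  back rt = SW
  back up = SE

  step-sq : ∀ w x y → step (dir w) (sq x y) ≡ sq (gx w x) (gy w y)
  step-sq rt x y = cong (λ n → sq n y) (ℕ.+-comm x 1)
  step-sq up x y = cong (sq x) (ℕ.+-comm y 1)

  step-sq² : ∀ w x y → step (dir w) (step (dir w) (sq x y)) ≡ sq (gx w (gx w x)) (gy w (gy w y))
  step-sq² w x y = trans (cong (step (dir w)) (step-sq w x y)) (step-sq w (gx w x) (gy w y))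

  step-back : ∀ w p → step (dir w) (step (back w) p) ≡ p
  step-back rt (a , b) = cong (_, b) (trans (ℤ.+-assoc a -1ℤ 1ℤ) (ℤ.+-identityʳ a))
  step-back up (a , b) = cong (a ,_) (trans (ℤ.+-assoc b -1ℤ 1ℤ) (ℤ.+-identityʳ b))

  back-step : ∀ w p → step (back w) (step (dir w) p) ≡ p
  back-step rt (a , b) = cong (_, b) (trans (ℤ.+-assoc a 1ℤ -1ℤ) (ℤ.+-identityʳ a))
  back-step up (a , b) = cong (a ,_) (trans (ℤ.+-assoc b 1ℤ -1ℤ) (ℤ.+-identityʳ b))

  step-injective : ∀ w {p q} → step (dir w) p ≡ step (dir w) q → p ≡ q
  step-injective w {p} {q} e = trans (sym (back-step w p)) (trans (cong (step (back w)) e) (back-step w q))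

  sq-injective : ∀ {x y x′ y′} → sq x y ≡ sq x′ y′ → x ≡ x′ × y ≡ y′
  sq-injective refl = refl , refl

  set-hit : ∀ b s m → set b s m s ≡ m
  set-hit b s m with s ≟ˢ s
  ... | yes _ = refl
  ... | no  n = ⊥-elim (n refl)

  set-miss : ∀ b {s} m {t} → t ≢ s → set b s m t ≡ b t
  set-miss b {s} m {t} t≢s with t ≟ˢ s
  ... | yes e = ⊥-elim (t≢s e)
  ... | no  _ = refl

  leap : Board → Square → Dir → Piece → Board
  leap b s d π = set (set (set b s nothing) (step d s) nothing) (step d (step d s)) (just π)

  module _ (b : Board) (s : Square) (d : Dir) (π : Piece) where

    leap-land : leap b s d π (step d (step d s)) ≡ just π
    leap-land = set-hit _ (step d (step d s)) _

    leap-mid : step d s ≢ step d (step d s) → leap b s d π (step d s) ≡ nothing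
    leap-mid n = trans (set-miss _ _ n) (set-hit _ (step d s) _)

    leap-miss : ∀ {t} → t ≢ s → t ≢ step d s → t ≢ step d (step d s) → leap b s d π t ≡ b t
    leap-miss s≢ m≢ l≢ = trans (set-miss _ _ l≢) (trans (set-miss _ _ m≢) (set-miss _ _ s≢))

    leap-src : s ≢ step d s → s ≢ step d (step d s) → leap b s d π s ≡ nothing
    leap-src m≢ l≢ = trans (set-miss _ _ l≢) (trans (set-miss _ _ m≢) (set-hit _ s _))

    leap-inv : ∀ {t ρ} → leap b s d π t ≡ just ρ →
               (t ≡ step d (step d s) × π ≡ ρ) ⊎ (t ≢ s × t ≢ step d s × b t ≡ just ρ)
    leap-inv {t} e with t ≟ˢ step d (step d s)
    ... | yes l = inj₁ (l , just-injective e)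
    ... | no  _ with t ≟ˢ step d s
    ... | yes _ with () ← e
    ... | no  m with t ≟ˢ s
    ... | yes _ with () ← e
    ... | no  n = inj₂ (n , m , e)

    leap-keep : ∀ {t ρ} → b (step d (step d s)) ≡ nothing → b t ≡ just ρ → t ≢ s → t ≢ step d s →
                leap b s d π t ≡ just ρ
    leap-keep {t} free e s≢ m≢ = trans (leap-miss s≢ m≢ l≢) e
      where
      l≢ : t ≢ step d (step d s)
      l≢ refl with () ← trans (sym e) free

  data Idle : Lab → Set where
    isIdle₁ : Idle idle₁
    isIdle₂ : Idle idle₂
    isIdleˡ : Idle idleˡ
    isIdleʳ : Idle idleʳ

  -- The labels of squares whose content never changes. The pawns `idleˡ` and `idleʳ` are both idle
  -- and frozen, because they never become runners.
  data Frozen : Lab → Set where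
    hard   : Frozen hard
    idleˡ  : Frozen idleˡ
    idleʳ  : Frozen idleʳ

  frozen-occupied : ∀ {l} → Frozen l → ∃ λ ρ → paint l ≡ just ρ
  frozen-occupied hard  = _ , refl
  frozen-occupied idleˡ = _ , refl
  frozen-occupied idleʳ = _ , refl

  Thawed : Square → Set
  Thawed p = ¬ Frozen (lab p)

  thawed : ∀ {p l} → lab p ≡ l → ¬ Frozen l → Thawed p
  thawed refl n = n

  None : Square → Set
  None _ = ⊥

  -- The invariants of play

  -- E holds of the runner, if there is one.
  record Core (b : Board) (E : Square → Set) : Set where
    field
      pawns  : ∀ {p c κ} → b p ≡ just (c , κ) → κ ≡ pawn
      frozen : ∀ {p} → Frozen (lab p) → b p ≡ B₀ p
      blacks : ∀ {p} → b p ≡ bp → E p ⊎ Idle (lab p)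

    frozen′ : ∀ {p l} → lab p ≡ l → Frozen l → b p ≡ paint l
    frozen′ refl = frozen

  -- Holds as long as White has not blundered; E holds of the idle pawn that has been unlocked, if any.
  record Tight (b : Board) (E : Square → Set) : Set where
    field
      firm : ∀ {p} → lab p ≡ hard₂ → b p ≡ wp
      shut : ∀ {p} → lab p ≡ idle₁ → b p ≡ bp →
             E p ⊎ (b (step NE p) ≡ wp × b (step NE (step NE p)) ≡ wp)

  module Leap {b : Board} {c : Colour} {s : Square} {d : Dir}
    (src : b s ≡ just (c , pawn)) (mid : b (step d s) ≡ just (opp c , pawn))
    (land : b (step d (step d s)) ≡ nothing) where

    π : Piece
    π = c , pawn

    b′ : Board
    b′ = leap b s d π

    -- The old runner, described by `E`, must be the pawn that jumps or the pawn that is taken; `E′`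
    -- describes the new one. After the capture of a runner, `E′` can be `None`.
    core : ∀ {E E′} → Core b E → Thawed s → Thawed (step d s) →
           (∀ {p} → E p → p ≡ s ⊎ p ≡ step d s) → (c ≡ black → E′ (step d (step d s))) → Core b′ E′
    core {E} {E′} C ts tm gone arrived = record
      { pawns  = λ {p} → pawns′ {p}
      ; frozen = λ {p} → frozen″ {p}
      ; blacks = λ {p} → blacks′ {p}
      }
      where
      open Core C
      pawns′ : ∀ {p c κ} → b′ p ≡ just (c , κ) → κ ≡ pawn
      pawns′ {p} e with leap-inv b s d π {p} e
      ... | inj₁ (_ , refl)  = refl
      ... | inj₂ (_ , _ , e) = pawns e
      frozen″ : ∀ {p} → Frozen (lab p) → b′ p ≡ B₀ p
      frozen″ {p} f with frozen-occupied f
      ... | ρ , o = trans (leap-keep b s d π {p} land (trans (frozen f) o)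
                            (λ { refl → ts f }) (λ { refl → tm f })) (sym o)
      blacks′ : ∀ {p} → b′ p ≡ bp → E′ p ⊎ Idle (lab p)
      blacks′ {p} e with leap-inv b s d π {p} e
      ... | inj₁ (refl , refl) = inj₁ (arrived refl)
      ... | inj₂ (p≢s , p≢m , e) with blacks e
      ... | inj₂ i = inj₂ i
      ... | inj₁ x with gone x
      ... | inj₁ p≡s = ⊥-elim (p≢s p≡s)
      ... | inj₂ p≡m = ⊥-elim (p≢m p≡m)

    -- A bar or a gate may be disturbed only if its idle pawn is handed over to `E′` as the unlocked
    -- one.
    tight : ∀ {E E′} → Tight b E →
      (∀ {p} → lab p ≡ hard₂ → p ≢ s × p ≢ step d s) →
      (∀ {p} → lab p ≡ idle₁ → b (step NE p) ≡ wp → b (step NE (step NE p)) ≡ wp → E′ p ⊎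
         ((step NE p ≢ s × step NE p ≢ step d s) ×
          (step NE (step NE p) ≢ s × step NE (step NE p) ≢ step d s))) →
      (∀ {p} → E p → p ≡ s ⊎ E′ p) → (c ≡ black → lab (step d (step d s)) ≢ idle₁) → Tight b′ E′
    tight {E} {E′} Tb ok ok′ gone arrived = record
      { firm = λ l → leap-keep b s d π land (firm l) (proj₁ (ok l)) (proj₂ (ok l))
      ; shut = λ {p} → shut′ {p}
      }
      where
      open Tight Tb
      shut′ : ∀ {p} → lab p ≡ idle₁ → b′ p ≡ bp →
              E′ p ⊎ (b′ (step NE p) ≡ wp × b′ (step NE (step NE p)) ≡ wp)
      shut′ {p} l e with leap-inv b s d π {p} e
      ... | inj₁ (refl , refl) = ⊥-elim (arrived refl l)
      ... | inj₂ (p≢s , _ , e) with shut l e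
      ... | inj₁ x with gone x
      ... | inj₁ p≡s = ⊥-elim (p≢s p≡s)
      ... | inj₂ x′  = inj₁ x′
      shut′ {p} l e | inj₂ _ | inj₂ (e₁ , e₂) with ok′ l e₁ e₂
      ... | inj₁ x′ = inj₁ x′
      ... | inj₂ ((a , b₁) , (c₁ , d₁)) =
        inj₂ (leap-keep b s d π land e₁ a b₁ , leap-keep b s d π land e₂ c₁ d₁)

  differ : ∀ {b : Board} {p q : Square} {x y} → b p ≡ x → b q ≡ y → x ≢ y → p ≢ q
  differ e f n refl = n (trans (sym e) f)

  lab-differ : ∀ {p q : Square} {x y} → lab p ≡ x → lab q ≡ y → x ≢ y → p ≢ q
  lab-differ e f n refl = n (trans (sym e) f)

  bar-gate : ∀ {p} → lab p ≡ idle₁ → lab (step NE p) ≡ bar × lab (step NE (step NE p)) ≡ gate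
  bar-gate l with around (λ ()) l
  ... | e ∷ g ∷ _ = e , g

  wp≢bp : wp ≢ bp
  wp≢bp ()

  module _ {b : Board} {s : Square} {d : Dir} where

    tight-black : b s ≡ bp → b (step d s) ≡ wp → b (step d (step d s)) ≡ nothing →
      lab (step d s) ≡ soft → lab (step d (step d s)) ≡ empty →
      Tight b None → Tight (leap b s d (black , pawn)) None
    tight-black src mid land sf em Tb = Leap.tight src mid land Tb
      (λ l → differ {b} (Tight.firm Tb l) src wp≢bp , lab-differ l sf λ ())
      (λ l e₁ e₂ → let x , y = bar-gate l in inj₂
        ((differ {b} e₁ src wp≢bp , lab-differ x sf λ ()) ,
         (differ {b} e₂ src wp≢bp , lab-differ y sf λ ())))
      (λ ()) (λ _ l → case (trans (sym em) l))
      where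
      case : empty ≢ idle₁
      case ()

    tight-white : b s ≡ wp → b (step d s) ≡ bp → b (step d (step d s)) ≡ nothing →
      lab s ≡ soft → Tight b None → Tight (leap b s d (white , pawn)) None
    tight-white src mid land sf Tb = Leap.tight src mid land Tb
      (λ l → lab-differ l sf (λ ()) , differ {b} (Tight.firm Tb l) mid wp≢bp)
      (λ l e₁ e₂ → let x , y = bar-gate l in inj₂
        ((lab-differ x sf (λ ()) , differ {b} e₁ mid wp≢bp) ,
         (lab-differ y sf (λ ()) , differ {b} e₂ mid wp≢bp)))
      (λ ()) (λ ())

  -- The moves that the invariants leave to each player.

  record Capture (b : Board) (E : Square → Set) (s : Square) (b′ : Board) : Set where
    field
      w     : Way
      p     : Square
      taken : E p
      from  : s ≡ step (dir w) p
      isB   : b p ≡ bp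
      isW   : b s ≡ wp
      land  : b (step (back w) p) ≡ nothing
      after : b′ ≡ leap b s (back w) (white , pawn)

  -- An idle pawn is safe from above because the square below it is `hard`. It is safe from the
  -- right because the landing square is occupied (`idle₁`, `idleʳ`) or because a black pawn stands
  -- where the capturing one would have to be (`idle₂`, `idleˡ`). Only the runner remains.
  white-captures : ∀ {b E s b′ s′} → Core b E → Jump white b s b′ s′ → Capture b E s b′
  white-captures {b} {E} {s} C (jump d κ κ′ bs al bm bl) with Core.pawns C bs | Core.pawns C bm
  white-captures {b} {E} {s} C (jump SE _ _ bs white-SE bm bl) | refl | refl with Core.blacks C bm
  ... | inj₁ x = record
    { w = up ; taken = x ; from = sym (step-back up s) ; isB = bm ; isW = bs ; land = bl ; after = refl }
  ... | inj₂ i = ⊥-elim (absurd refl i)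
    where
    full : lab (step SE (step SE s)) ≢ hard
    full l with () ← trans (sym (Core.frozen′ C l hard)) bl
    absurd : ∀ {l} → lab (step SE s) ≡ l → Idle l → ⊥
    absurd l isIdle₁ with around (λ ()) l
    ... | _ ∷ _ ∷ _ ∷ _ ∷ _ ∷ h ∷ [] = full h
    absurd l isIdle₂ with around (λ ()) l
    ... | _ ∷ _ ∷ _ ∷ h ∷ [] = full h
    absurd l isIdleˡ with around (λ ()) l
    ... | _ ∷ _ ∷ _ ∷ h ∷ [] = full h
    absurd l isIdleʳ with around (λ ()) l
    ... | _ ∷ _ ∷ _ ∷ _ ∷ _ ∷ h ∷ [] = full h
  white-captures {b} {E} {s} C (jump SW _ _ bs white-SW bm bl) | refl | refl with Core.blacks C bm
  ... | inj₁ x = record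
    { w = rt ; taken = x ; from = sym (step-back rt s) ; isB = bm ; isW = bs ; land = bl ; after = refl }
  ... | inj₂ i = ⊥-elim (absurd refl i)
    where
    eastWhite : ∀ {l} → lab (step NE (step SW s)) ≡ l → Frozen l → paint l ≢ bp
    eastWhite l f e
      with () ← trans (sym (trans (cong b (step-back rt s)) bs)) (trans (Core.frozen′ C l f) e)
    absurd : ∀ {l} → lab (step SW s) ≡ l → Idle l → ⊥
    absurd l isIdle₁ with around (λ ()) l
    ... | _ ∷ _ ∷ _ ∷ _ ∷ h ∷ _ with () ← trans (sym (Core.frozen′ C h hard)) bl
    absurd l isIdle₂ with around (λ ()) l
    ... | h ∷ _ = eastWhite h idleˡ refl
    absurd l isIdleˡ with around (λ ()) l
    ... | h ∷ _ = eastWhite h idleʳ refl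
    absurd l isIdleʳ with around (λ ()) l
    ... | _ ∷ _ ∷ _ ∷ _ ∷ h ∷ _ with () ← trans (sym (Core.frozen′ C h idleˡ)) bl

  Blocked : Board → Square → Dir → Set
  Blocked b p d = b (step d p) ≡ bp ⊎ (b (step d p) ≡ wp × b (step d (step d p)) ≡ wp)

  module _ {b : Board} {E E′ : Square → Set} (C : Core b E) (Tb : Tight b E′) where
    open Core C
    open Tight Tb

    -- Upwards there are two white pawns that are frozen or firm. To the right there is a black
    -- pawn, or two frozen white ones, or a bar and a gate; this last block is the one that White's
    -- capture from above removes, whence the alternative `E′ p`.
    idle-blocked : ∀ {p l} → b p ≡ bp → lab p ≡ l → Idle l → (E′ p ⊎ Blocked b p NE) × Blocked b p NW
    idle-blocked e l isIdle₁ with around (λ ()) l | shut l e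
    ... | _ ∷ _ ∷ n ∷ n′ ∷ _ | inj₁ x = inj₁ x , inj₂ (frozen′ n hard , frozen′ n′ hard)
    ... | _ ∷ _ ∷ n ∷ n′ ∷ _ | inj₂ g = inj₂ (inj₂ g) , inj₂ (frozen′ n hard , frozen′ n′ hard)
    idle-blocked e l isIdle₂ with around (λ ()) l
    ... | x ∷ n ∷ n′ ∷ _ = inj₂ (inj₁ (frozen′ x idleˡ)) , inj₂ (firm n , firm n′)
    idle-blocked e l isIdleˡ with around (λ ()) l
    ... | x ∷ n ∷ n′ ∷ _ = inj₂ (inj₁ (frozen′ x idleʳ)) , inj₂ (frozen′ n hard , frozen′ n′ hard)
    idle-blocked e l isIdleʳ with around (λ ()) l
    ... | x ∷ x′ ∷ n ∷ n′ ∷ _ =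
      inj₂ (inj₂ (frozen′ x hard , frozen′ x′ hard)) , inj₂ (frozen′ n hard , frozen′ n′ hard)

    record BlackJump (s : Square) (b′ : Board) (s′ : Square) : Set where
      field
        w     : Way
        who   : E s ⊎ (E′ s × w ≡ rt)
        isB   : b s ≡ bp
        isW   : b (step (dir w) s) ≡ wp
        land  : b (step (dir w) (step (dir w) s)) ≡ nothing
        after : b′ ≡ leap b s (dir w) (black , pawn)
        there : s′ ≡ step (dir w) (step (dir w) s)

    blocked-no-jump : ∀ p d → Blocked b p d → b (step d p) ≡ wp → b (step d (step d p)) ≡ nothing → ⊥
    blocked-no-jump _ _ (inj₁ e)       f g with () ← trans (sym e) f
    blocked-no-jump _ _ (inj₂ (_ , e)) f g with () ← trans (sym e) g

    blocked-no-step : ∀ p d → Blocked b p d → b (step d p) ≢ nothing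
    blocked-no-step _ _ (inj₁ e)       g with () ← trans (sym e) g
    blocked-no-step _ _ (inj₂ (e , _)) g with () ← trans (sym e) g

    black-jumps : ∀ {s b′ s′} → Jump black b s b′ s′ → BlackJump s b′ s′
    black-jumps (jump d κ κ′ bs al bm bl) with pawns bs | pawns bm
    black-jumps {s} (jump NE _ _ bs black-NE bm bl) | refl | refl = record
      { w = rt ; who = who ; isB = bs ; isW = bm ; land = bl ; after = refl ; there = refl }
      where
      who : E s ⊎ (E′ s × rt ≡ rt)
      who with blacks bs
      ... | inj₁ x = inj₁ x
      ... | inj₂ i with proj₁ (idle-blocked bs refl i)
      ... | inj₁ x = inj₂ (x , refl)
      ... | inj₂ x = ⊥-elim (blocked-no-jump s NE x bm bl)
    black-jumps {s} (jump NW _ _ bs black-NW bm bl) | refl | refl = record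
      { w = up ; who = who ; isB = bs ; isW = bm ; land = bl ; after = refl ; there = refl }
      where
      who : E s ⊎ (E′ s × up ≡ rt)
      who with blacks bs
      ... | inj₁ x = inj₁ x
      ... | inj₂ i = ⊥-elim (blocked-no-jump s NW (proj₂ (idle-blocked bs refl i)) bm bl)

  black-stuck : ∀ {b} → Core b None → Tight b None → Stuck ⟨ b , black ⟩
  black-stuck C Tb _ (jumpMove (one j))    with BlackJump.who (black-jumps C Tb j)
  ... | inj₁ ()
  ... | inj₂ ()
  black-stuck C Tb _ (jumpMove (more j _)) with BlackJump.who (black-jumps C Tb j)
  ... | inj₁ ()
  ... | inj₂ ()
  black-stuck C Tb _ (simpleMove _ (simple s d κ bs al free)) with Core.pawns C bs
  ... | refl with Core.blacks C bs
  ... | inj₂ i with idle-blocked C Tb bs refl i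
  black-stuck C Tb _ (simpleMove _ (simple s .NE .pawn bs black-NE free)) | refl | inj₂ i | inj₂ r , _ =
    blocked-no-step C Tb s NE r free
  black-stuck C Tb _ (simpleMove _ (simple s .NW .pawn bs black-NW free)) | refl | inj₂ i | _ , u =
    blocked-no-step C Tb s NW u free

  -- The squares above or to the right of (X , Y), which a runner at (X , Y) finds untouched because
  -- all earlier play went right or up.
  After : ℕ → ℕ → ℕ → ℕ → Set
  After X Y x y = Y < y ⊎ (Y ≡ y × X < x)

  Ahead : Board → ℕ → ℕ → Set
  Ahead b X Y = ∀ {x y} → After X Y x y → b (sq x y) ≡ B₀ (sq x y)

  Out : Square → ℕ → ℕ → Set
  Out p X Y = ∀ {x y} → After X Y x y → sq x y ≢ p

  after-narrow : ∀ w {X Y x y} → After (gx w X) (gy w Y) x y → After X Y x y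
  after-narrow rt (inj₁ a)          = inj₁ a
  after-narrow rt (inj₂ (e , a))    = inj₂ (e , ℕ.<-trans (ℕ.n<1+n _) a)
  after-narrow up (inj₁ a)          = inj₁ (ℕ.<-trans (ℕ.n<1+n _) a)
  after-narrow up (inj₂ (refl , _)) = inj₁ (ℕ.n<1+n _)

  after-go : ∀ w {X Y x y} → After X Y x y → After X Y (gx w x) (gy w y)
  after-go rt (inj₁ a)          = inj₁ a
  after-go rt (inj₂ (e , a))    = inj₂ (e , ℕ.m<n⇒m<1+n a)
  after-go up (inj₁ a)          = inj₁ (ℕ.m<n⇒m<1+n a)
  after-go up (inj₂ (refl , _)) = inj₁ (ℕ.n<1+n _)

  after-next : ∀ w {X Y} → After X Y (gx w X) (gy w Y)
  after-next rt = inj₂ (refl , ℕ.n<1+n _)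
  after-next up = inj₁ (ℕ.n<1+n _)

  out-self : ∀ {X Y} → Out (sq X Y) X Y
  out-self (inj₁ a)       e = ℕ.<-irrefl (sym (proj₂ (sq-injective e))) a
  out-self (inj₂ (_ , a)) e = ℕ.<-irrefl (sym (proj₁ (sq-injective e))) a

  out-≡ : ∀ {p X Y} → p ≡ sq X Y → Out p X Y
  out-≡ refl = out-self

  out-step : ∀ w {p X Y} → Out (step (dir w) p) X Y → Out p X Y
  out-step w o {x} {y} a refl = o (after-go w a) (sym (step-sq w x y))

  ahead-leap : ∀ {b s d π X Y X′ Y′} → Ahead b X Y → (∀ {x y} → After X′ Y′ x y → After X Y x y) →
    Out s X′ Y′ → Out (step d s) X′ Y′ → Out (step d (step d s)) X′ Y′ → Ahead (leap b s d π) X′ Y′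
  ahead-leap {b} {s} {d} {π} A sub o₁ o₂ o₃ a =
    trans (leap-miss b s d π (o₁ a) (o₂ a) (o₃ a)) (A (sub a))

  -- The runner and his paths.

  record Runner (b : Board) (p : Square) (X Y : ℕ) : Set where
    field
      at    : p ≡ sq X Y
      core  : Core b (_≡ p)
      on    : b p ≡ bp
      ahead : Ahead b X Y
      thaw  : Thawed p

  black-jump : ∀ {b p} w → b p ≡ bp → b (step (dir w) p) ≡ wp →
    b (step (dir w) (step (dir w) p)) ≡ nothing →
    Jump black b p (leap b p (dir w) (black , pawn)) (step (dir w) (step (dir w) p))
  black-jump rt e f g = jump NE pawn pawn e black-NE f g
  black-jump up e f g = jump NW pawn pawn e black-NW f g

  module _ {b : Board} {p : Square} {X Y : ℕ} (r : Runner b p X Y) (w : Way) where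
    open Runner r

    next-at : step (dir w) p ≡ sq (gx w X) (gy w Y)
    next-at = trans (cong (step (dir w)) at) (step-sq w X Y)

    land-at : step (dir w) (step (dir w) p) ≡ sq (gx w (gx w X)) (gy w (gy w Y))
    land-at = trans (cong (step (dir w) ∘ step (dir w)) at) (step-sq² w X Y)

    next-lab : ∀ {l} → lab (sq (gx w X) (gy w Y)) ≡ l → lab (step (dir w) p) ≡ l
    next-lab e = trans (cong lab next-at) e

    land-lab : ∀ {l} → lab (sq (gx w (gx w X)) (gy w (gy w Y))) ≡ l →
               lab (step (dir w) (step (dir w) p)) ≡ l
    land-lab e = trans (cong lab land-at) e

    next-is : ∀ {l} → lab (sq (gx w X) (gy w Y)) ≡ l → b (step (dir w) p) ≡ paint l
    next-is refl = trans (cong b next-at) (ahead (after-next w))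

    land-is : ∀ {l} → lab (sq (gx w (gx w X)) (gy w (gy w Y))) ≡ l →
              b (step (dir w) (step (dir w) p)) ≡ paint l
    land-is refl = trans (cong b land-at) (ahead (after-go w (after-next w)))

    hop : b (step (dir w) p) ≡ wp → b (step (dir w) (step (dir w) p)) ≡ nothing →
      Thawed (step (dir w) p) → Thawed (step (dir w) (step (dir w) p)) →
      Runner (leap b p (dir w) (black , pawn)) (step (dir w) (step (dir w) p))
             (gx w (gx w X)) (gy w (gy w Y))
    hop mid land tm tl = record
      { at    = land-at
      ; core  = Leap.core on mid land core thaw tm inj₁ (λ _ → refl)
      ; on    = leap-land b p (dir w) _
      ; ahead = ahead-leap ahead (after-narrow w ∘ after-narrow w)
                (out-step w (out-step w o)) (out-step w o) o
      ; thaw  = tl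
      }
      where
      o = out-≡ land-at

    advance : lab (sq (gx w X) (gy w Y)) ≡ soft → lab (sq (gx w (gx w X)) (gy w (gy w Y))) ≡ empty →
      Jump black b p (leap b p (dir w) (black , pawn)) (step (dir w) (step (dir w) p)) ×
      Runner (leap b p (dir w) (black , pawn)) (step (dir w) (step (dir w) p))
             (gx w (gx w X)) (gy w (gy w Y))
    advance sf em =
      black-jump w on (next-is sf) (land-is em) ,
      hop (next-is sf) (land-is em) (thawed (next-lab sf) λ ()) (thawed (land-lab em) λ ())

  data Path : Board → Square → Board → Square → Set where
    []  : ∀ {b s} → Path b s b s
    _∷_ : ∀ {b s b′ s′ b″ s″} → Jump black b s b′ s′ → Path b′ s′ b″ s″ → Path b s b″ s″

  _⊕_ : ∀ {b s b′ s′ b″ s″} → Path b s b′ s′ → Path b′ s′ b″ s″ → Path b s b″ s″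
  []      ⊕ q = q
  (j ∷ p) ⊕ q = j ∷ (p ⊕ q)

  jumps : ∀ {b s b′ s′ b″ s″} → Jump black b s b′ s′ → Path b′ s′ b″ s″ → Jumps black b s b″
  jumps j []       = one j
  jumps j (j′ ∷ p) = more j (jumps j′ p)

  abstract

    run : ∀ ds {b p X Y} → Runner b p X Y → Free ds X Y →
          ∃ λ b′ → ∃ λ p′ → Path b p b′ p′ × Runner b′ p′ (walkˣ ds X) (walkʸ ds Y)
    run []       r _ = _ , _ , [] , r
    run (w ∷ ds) r (sf , em , fr) with advance r w sf em
    ... | j , r′ with run ds r′ fr
    ... | b″ , p″ , path , r″ = b″ , p″ , j ∷ path , r″

  -- Until its first jump the unlocked pawn counts among the idle ones, so the invariant here is
  -- that there is no runner.
  record Start (b : Board) (p : Square) (w : Way) (X Y : ℕ) : Set where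
    field
      core  : Core b None
      on    : b p ≡ bp
      lock  : b (step (dir w) p) ≡ wp
      land  : b (step (dir w) (step (dir w) p)) ≡ nothing
      at    : step (dir w) (step (dir w) p) ≡ sq X Y
      ahead : Ahead b X Y
      thaw  : Thawed p
      thaw₁ : Thawed (step (dir w) p)
      thaw₂ : Thawed (step (dir w) (step (dir w) p))

    launch : Jump black b p (leap b p (dir w) (black , pawn)) (step (dir w) (step (dir w) p)) ×
             Runner (leap b p (dir w) (black , pawn)) (step (dir w) (step (dir w) p)) X Y
    launch = black-jump w on lock land , record
      { at    = at
      ; core  = Leap.core on lock land core thaw thaw₁ (λ ()) (λ _ → refl)
      ; on    = leap-land b p (dir w) _
      ; ahead = ahead-leap ahead (λ a → a) (out-step w (out-step w (out-≡ at)))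
                (out-step w (out-≡ at)) (out-≡ at)
      ; thaw  = thaw₂
      }

  record AtOrigin (b : Board) (p : Square) (k j : ℕ) (L : Lane) : Set where
    constructor origin
    field
      runner : Runner b p (orgˣ (eps L) + k * 10) (bit (del L) + j * 12)
      lane   : content k j ≡ L

  -- Black to move, with a pawn p that can jump through a gate into the corridor L.
  record Begin (b : Board) (L : Lane) : Set where
    field
      p     : Square
      w     : Way
      X Y   : ℕ
      ds    : List Way
      k j   : ℕ
      start : Start b p w X Y
      free  : Free ds X Y
      endˣ  : walkˣ ds X ≡ orgˣ (eps L) + k * 10
      endʸ  : walkʸ ds Y ≡ bit (del L) + j * 12
      lane  : content k j ≡ L

    toOrigin : ∃ λ b′ → ∃ λ s′ → ∃ λ b″ → ∃ λ p″ →
               Jump black b p b′ s′ × Path b′ s′ b″ p″ × AtOrigin b″ p″ k j L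
    toOrigin with Start.launch start
    ... | j′ , r with run ds r free
    ... | b″ , p″ , path , r″ = _ , _ , b″ , p″ , j′ , path ,
      origin (subst₂ (Runner b″ p″) endˣ endʸ r″) lane

  -- Travelling along a corridor from fork to fork.

  cellAt-≡ : ∀ k j {i s L} → fromLeft k j ≡ i → shapeAt k j ≡ s → content k j ≡ L →
             cellAt k j ≡ cell i (drawn s L) (eps L) (del L)
  cellAt-≡ k j refl refl refl = refl

  drawn-≢upward : ∀ {s} L → s ≢ upward → drawn s L ≢ upward
  drawn-≢upward {straight} L n = n
  drawn-≢upward {upward}   L n = n
  drawn-≢upward {join}     L n = n
  drawn-≢upward {fork}     L n with is-just (nth L 0)
  ... | true  = λ ()
  ... | false = λ ()

  goʳ-eps : ∀ s L → eps (goʳ s L) ≡ eps L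
  goʳ-eps straight L = refl
  goʳ-eps upward   L = refl
  goʳ-eps join     L = refl
  goʳ-eps fork     (fin _ _) = refl
  goʳ-eps fork     (inf _ _) = refl

  goʳ-del : ∀ s L → del (goʳ s L) ≡ del L
  goʳ-del straight L = refl
  goʳ-del upward   L = refl
  goʳ-del join     L = refl
  goʳ-del fork     (fin _ _) = refl
  goʳ-del fork     (inf _ _) = refl

  endR⁵ : ∀ ε k → walkˣ R⁵ (orgˣ ε + k * 10) ≡ orgˣ ε + suc k * 10
  endR⁵ false k = refl
  endR⁵ true  k = refl

  endU⁶ : ∀ δ j → walkʸ U⁶ (bit δ + j * 12) ≡ bit δ + suc j * 12
  endU⁶ false j = refl
  endU⁶ true  j = refl

  content-straight : ∀ k j {s L} → shapeAt k j ≡ s → s ≢ upward → content k j ≡ L →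
                     content (suc k) j ≡ goʳ s L
  content-straight k j e n c = trans (proj₂ (content-rt k j (n ∘ trans (sym e)))) (cong₂ goʳ e c)

  content-upward : ∀ k j {s L} → shapeAt k j ≡ s → s ≢ straight → content k j ≡ L →
                   content k (suc j) ≡ goᵘ s L
  content-upward k j e n c = trans (content-up k j (n ∘ trans (sym e))) (cong₂ goᵘ e c)

  module _ (k j : ℕ) {L : Lane} {s : Shape} (c : content k j ≡ L) (e : shapeAt k j ≡ s) where

    block-rt : s ≢ upward →
      Block k j (cell (fromLeft k j) (drawn s L) (eps L) (del L))
                (cell true (drawn (shapeAt (suc k) j) (goʳ s L)) (eps L) (del L))
                (cellAt k (suc j)) (cellAt (suc k) (suc j))
    block-rt n with content-rt k j (n ∘ trans (sym e))
    ... | l , c′ = block (cellAt-≡ k j refl e c)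
      (trans (cellAt-≡ (suc k) j l refl (trans c′ (cong₂ goʳ e c)))
             (cong₂ (cell true _) (goʳ-eps s L) (goʳ-del s L)))
      refl refl

    block-up : s ≢ straight →
      Block k j (cell (fromLeft k j) (drawn s L) (eps L) (del L)) (cellAt (suc k) j)
                (cell (fromLeft k (suc j)) (drawn (shapeAt k (suc j)) (goᵘ s L))
                  (eps (goᵘ s L)) (del (goᵘ s L)))
                (cellAt (suc k) (suc j))
    block-up n = block (cellAt-≡ k j refl e c) refl
      (cellAt-≡ k (suc j) refl refl (content-upward k j e n c)) refl

  go-rt : ∀ {b p k j L s} → AtOrigin b p k j L → shapeAt k j ≡ s → s ≢ upward →
    ∃ λ b′ → ∃ λ p′ → Path b p b′ p′ × AtOrigin b′ p′ (suc k) j (goʳ s L)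
  go-rt {k = k} {j} {L} {s} (origin r c) e n
    with run R⁵ r (free-straight (block-rt k j c e n) (drawn-≢upward L n))
  ... | b′ , p′ , path , r′ = b′ , p′ , path , origin
    (subst₂ (Runner b′ p′)
      (trans (endR⁵ (eps L) k) (cong (λ ε → orgˣ ε + suc k * 10) (sym (goʳ-eps s L))))
      (cong (λ δ → bit δ + j * 12) (sym (goʳ-del s L))) r′)
    (content-straight k j e n c)

  go-up : ∀ {b p k j L} → AtOrigin b p k j L → shapeAt k j ≡ upward →
    ∃ λ b′ → ∃ λ p′ → Path b p b′ p′ × AtOrigin b′ p′ k (suc j) L
  go-up {k = k} {j} {L} (origin r c) e
    with run U⁶ r (free-upward (eps L) (del L) (block-up k j c e λ ()))
  ... | b′ , p′ , path , r′ = b′ , p′ , path , origin (subst (Runner b′ p′ _) (endU⁶ (del L) j) r′)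
    (content-upward k j e (λ ()) c)

  shape-fork : ∀ j → shape j (suc (double j)) ≡ fork
  shape-fork zero    = refl
  shape-fork (suc j) = shape-fork j

  shape-straight : ∀ j d → shape j (suc (d + suc (double j))) ≡ straight
  shape-straight zero    d rewrite ℕ.+-comm d 1 = refl
  shape-straight (suc j) d rewrite ℕ.+-suc d (suc (suc (double j))) | ℕ.+-suc d (suc (double j)) =
    shape-straight j d

  shape-low : ∀ j r → r ≤ double j → shape j r ≡ upward ⊎ shape j r ≡ join
  shape-low zero    zero          _                 = inj₂ refl
  shape-low (suc j) zero          _                 = inj₁ refl
  shape-low (suc j) (suc zero)    _                 = inj₁ refl
  shape-low (suc j) (suc (suc r)) (s≤s (s≤s r≤2j)) = shape-low j r r≤2j

  double-+ : ∀ k j → double (k + j) ≡ double k + double j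
  double-+ zero    j = refl
  double-+ (suc k) j = cong (suc ∘ suc) (double-+ k j)

  time-tick : ∀ k j {r} → time k j ≡ r → time (suc k) j ≡ tick (k + j) r
  time-tick k j refl = time-suc k j

  record AtFork (b : Board) (p : Square) (L : Lane) : Set where
    field
      {b′}   : Board
      {p′}   : Square
      {k j}  : ℕ
      path   : Path b p b′ p′
      here   : AtOrigin b′ p′ k j L
      isFork : shapeAt k j ≡ fork

  prepend : ∀ {b p b′ p′ L} → Path b p b′ p′ → AtFork b′ p′ L → AtFork b p L
  prepend q f = record { path = q ⊕ AtFork.path f ; here = AtFork.here f ; isFork = AtFork.isFork f }

  -- The corridor goes right until the clock has come down to it.
  descend : ∀ d k j {b p L} → time k j ≡ d + suc (double j) → AtOrigin b p k j L → AtFork b p L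
  descend zero    k j e o = record
    { path = [] ; here = o ; isFork = trans (cong (shape j) e) (shape-fork j) }
  descend (suc d) k j e o
    with go-rt o (trans (cong (shape j) e) (shape-straight j d)) (λ ())
  ... | _ , _ , path , o′ = prepend path (descend d (suc k) j (time-tick k j e) o′)

  -- The clock has passed the corridor, which is pushed up until the clock restarts.
  rise : ∀ r k j {b p L} → time k j ≡ r → r ≤ double j → AtOrigin b p k j L → AtFork b p L
  rise r k j e r≤2j o with shape-low j r r≤2j
  rise zero k j e r≤2j o | inj₁ u with go-up o (trans (cong (shape j) e) u)
  -- The restarted clock shows `3 + 2 (k + j)` and row `suc j` forks at `3 + 2 j`, which leaves
  -- `2 k` stages. In the next case row `j` forks at `1 + 2 j`, two stages later.
  ... | _ , _ , path , o′ = prepend path (descend (double k) k (suc j) eq o′)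
    where
    eq : time (suc k) j ≡ double k + (3 + double j)
    eq = trans (time-tick k j e) (trans (cong (λ n → 3 + n) (double-+ k j)) (sym (trans (ℕ.+-suc _ _)
           (cong suc (trans (ℕ.+-suc _ _) (cong suc (ℕ.+-suc _ _)))))))
  rise zero k j e r≤2j o | inj₂ u with go-rt o (trans (cong (shape j) e) u) (λ ())
  ... | _ , _ , path , o′ = prepend path (descend (double (suc k)) (suc k) j eq o′)
    where
    eq : time (suc k) j ≡ double (suc k) + suc (double j)
    eq = trans (time-tick k j e) 
      (trans (cong (λ n → 3 + n) (double-+ k j)) (cong (λ n → 2 + n) (sym (ℕ.+-suc _ _))))
  rise (suc r) k j e r≤2j o | inj₁ u with go-up o (trans (cong (shape j) e) u)
  ... | _ , _ , path , o′ =
    prepend path (rise r k (suc j) (time-tick k j e)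
      (ℕ.≤-trans (ℕ.≤-trans (ℕ.n≤1+n r) r≤2j) (ℕ.m≤n+m _ 2)) o′)
  rise (suc r) k j e r≤2j o | inj₂ u with go-rt o (trans (cong (shape j) e) u) (λ ())
  ... | _ , _ , path , o′ =
    prepend path (rise r (suc k) j (time-tick k j e) (ℕ.≤-trans (ℕ.n≤1+n r) r≤2j) o′)

  seek : ∀ k j {b p L} → AtOrigin b p k j L → AtFork b p L
  seek k j o with ℕ.<-≤-connex (double j) (time k j)
  ... | inj₂ le = rise (time k j) k j refl le o
  ... | inj₁ gt = descend (time k j ℕ.∸ suc (double j)) k j (sym (ℕ.m∸n+n≡m gt)) o

  nth-tail : ∀ L n → nth (tail L) n ≡ nth L (suc n)
  nth-tail (fin _ _) n = refl
  nth-tail (inf _ _) n = refl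

  -- The runner goes straight on at the first `n` forks. Each of them uses up one entry of the lane,
  -- whether or not a child is there.
  reach : ∀ n k j {b p L L′} → nth L n ≡ just L′ → AtOrigin b p k j L →
          ∃ λ M → AtFork b p M × nth M 0 ≡ just L′
  reach zero    k j {L = L} e o = L , seek k j o , e
  reach (suc n) k j {L = L} e o with seek k j o
  ... | record { path = q ; here = o′ ; isFork = f } with go-rt o′ f (λ ())
  ... | _ , _ , q′ , o″ with reach n _ _ (trans (nth-tail L n) e) o″
  ... | M , fk , e′ = M , prepend (q ⊕ q′) fk , e′

  -- White's captures in the dead end.

  sq-≢ˣ : ∀ {x y x′ y′} → x ≢ x′ → sq x y ≢ sq x′ y′
  sq-≢ˣ n e = n (proj₁ (sq-injective e))

  sq-≢ʸ : ∀ {x y x′ y′} → y ≢ y′ → sq x y ≢ sq x′ y′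
  sq-≢ʸ n e = n (proj₂ (sq-injective e))

  module Capturing {b : Board} {p : Square} (C : Core b (_≡ p)) (on : b p ≡ bp)
    (thaw : Thawed p) (w : Way)
    (isW : b (step (dir w) p) ≡ wp) (land : b (step (back w) p) ≡ nothing) where

    s : Square
    s = step (dir w) p

    after : Board
    after = leap b s (back w) (white , pawn)

    mid′ : b (step (back w) s) ≡ bp
    mid′ = trans (cong b (back-step w p)) on

    land′ : b (step (back w) (step (back w) s)) ≡ nothing
    land′ = trans (cong (b ∘ step (back w)) (back-step w p)) land

    white-jump : Jump white b s after (step (back w) (step (back w) s))
    white-jump = go w isW mid′ land′
      where
      go : ∀ w {s} → b s ≡ wp → b (step (back w) s) ≡ bp →
           b (step (back w) (step (back w) s)) ≡ nothing →
           Jump white b s (leap b s (back w) (white , pawn)) (step (back w) (step (back w) s))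
      go rt e f g = jump SW pawn pawn e white-SW f g
      go up e f g = jump SE pawn pawn e white-SE f g

    core : Thawed s → Core after None
    core ts = Leap.core isW mid′ land′ C ts (λ f → thaw (subst (Frozen ∘ lab) (back-step w p) f))
      (λ e → inj₂ (trans e (sym (back-step w p)))) (λ ())

    keep : ∀ {t ρ} → b t ≡ just ρ → t ≢ s → t ≢ p → after t ≡ just ρ
    keep e n m = leap-keep b s (back w) _ land′ e n (λ q → m (trans q (back-step w p)))

    gone : after s ≡ nothing
    gone = leap-src b s (back w) _ (differ {b} isW mid′ (λ ())) (differ {b} isW land′ (λ ()))

    ahead : ∀ {X Y} → p ≡ sq X Y → Ahead b X Y → Ahead after (gx w X) (gy w Y)
    ahead {X} {Y} at A = ahead-leap A (after-narrow w) o₁ (out-≡′ o₂ (back-step w p))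
      (out-≡′ o₃ (cong (step (back w)) (back-step w p)))
      where
      out-≡′ : ∀ {p q} → Out p (gx w X) (gy w Y) → q ≡ p → Out q (gx w X) (gy w Y)
      out-≡′ o refl = o
      o₁ : Out s (gx w X) (gy w Y)
      o₁ = out-≡ (trans (cong (step (dir w)) at) (step-sq w X Y))
      o₂ : Out p (gx w X) (gy w Y)
      o₂ = out-step w o₁
      o₃ : Out (step (back w) p) (gx w X) (gy w Y)
      o₃ = out-step w (out-≡′ o₂ (step-back w p))

  record Trapped (b : Board) (x y : ℕ) : Set where
    field
      runner : Runner b (sq (3 + x) (6 + y)) (3 + x) (6 + y)
      labels : ForkLabels x y
      under  : b (sq (3 + x) (5 + y)) ≡ nothing

    open Runner runner public
    open ForkLabels labels public

    module V₁ = Capturing core on thaw up (next-is runner up labGate₁) under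

    gate₁ : step NW (sq (3 + x) (6 + y)) ≡ sq (3 + x) (7 + y)
    gate₁ = step-sq up (3 + x) (6 + y)

    start₁ : Start V₁.after (sq (1 + x) (7 + y)) rt (3 + x) (7 + y)
    start₁ = record
      { core  = V₁.core (thawed (next-lab runner up labGate₁) λ ())
      ; on    = V₁.keep q₁ (differ {b} q₁ (next-is runner up labGate₁) (λ ()))
                  (lab-differ labQ₁ labEnd (λ ()))
      ; lock  = trans (cong V₁.after (step-sq rt (1 + x) (7 + y)))
                  (V₁.keep bar₁ (lab-differ labBar₁ (next-lab runner up labGate₁) (λ ()))
                    (lab-differ labBar₁ labEnd (λ ())))
      ; land  = trans (cong V₁.after (trans (step-sq² rt (1 + x) (7 + y)) (sym gate₁))) V₁.gone
      ; at    = step-sq² rt (1 + x) (7 + y)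
      ; ahead = V₁.ahead refl ahead
      ; thaw  = thawed labQ₁ λ ()
      ; thaw₁ = thawed (trans (cong lab (step-sq rt (1 + x) (7 + y))) labBar₁) λ ()
      ; thaw₂ = thawed (trans (cong lab (step-sq² rt (1 + x) (7 + y))) labGate₁) λ ()
      }
      where
      q₁ : b (sq (1 + x) (7 + y)) ≡ bp
      q₁ = trans (ahead (inj₁ (ℕ.n<1+n _))) (cong paint labQ₁)
      bar₁ : b (sq (2 + x) (7 + y)) ≡ wp
      bar₁ = trans (ahead (inj₁ (ℕ.n<1+n _))) (cong paint labBar₁)

  -- This adds what the capture from the right requires. In the upper bound White captures from
  -- above, as prepared by `Trapped`; the lower bound has to consider both captures.
  record Trapped⁺ (b : Board) (x y : ℕ) : Set where
    field
      trapped : Trapped b x y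
      slot    : b (sq (2 + x) (6 + y)) ≡ nothing
      q₂      : b (sq (4 + x) (4 + y)) ≡ bp
      bar₂    : b (sq (4 + x) (5 + y)) ≡ wp

    open Trapped trapped public

    module V₂ = Capturing core on thaw rt (next-is runner rt labGate₂) slot

    gate₂ : step NE (sq (3 + x) (6 + y)) ≡ sq (4 + x) (6 + y)
    gate₂ = step-sq rt (3 + x) (6 + y)

    start₂ : Start V₂.after (sq (4 + x) (4 + y)) up (4 + x) (6 + y)
    start₂ = record
      { core  = V₂.core (thawed (next-lab runner rt labGate₂) λ ())
      ; on    = V₂.keep q₂ (differ {b} q₂ (next-is runner rt labGate₂) (λ ()))
                  (lab-differ labQ₂ labEnd (λ ()))
      ; lock  = trans (cong V₂.after (step-sq up (4 + x) (4 + y)))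
                  (V₂.keep bar₂ (λ e → sq-≢ʸ (ℕ.<⇒≢ (ℕ.n<1+n _)) (trans e gate₂))
                    (lab-differ labBar₂ labEnd (λ ())))
      ; land  = trans (cong V₂.after (trans (step-sq² up (4 + x) (4 + y)) (sym gate₂))) V₂.gone
      ; at    = step-sq² up (4 + x) (4 + y)
      ; ahead = V₂.ahead refl ahead
      ; thaw  = thawed labQ₂ λ ()
      ; thaw₁ = thawed (trans (cong lab (step-sq up (4 + x) (4 + y))) labBar₂) λ ()
      ; thaw₂ = thawed (trans (cong lab (step-sq² up (4 + x) (4 + y))) labGate₂) λ ()
      }

    -- A jump is available and hence forced; it must take the runner, and with the runner gone it
    -- cannot be continued. The side from which White captures is the only choice.
    replies : ∀ {t} → Move ⟨ b , white ⟩ t → t ≡ ⟨ V₁.after , black ⟩ ⊎ t ≡ ⟨ V₂.after , black ⟩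
    replies (jumpMove (one j)) with white-captures core j
    ... | record { w = up ; taken = refl ; from = refl ; after = refl } = inj₁ refl
    ... | record { w = rt ; taken = refl ; from = refl ; after = refl } = inj₂ refl
    replies (jumpMove (more j js)) with white-captures core j
    ... | record { w = up ; taken = refl ; from = refl ; after = refl } = ⊥-elim (over js)
      where
      over : ∀ {s b″} → Jumps white V₁.after s b″ → ⊥
      over (one j′)    = Capture.taken (white-captures (Start.core start₁) j′)
      over (more j′ _) = Capture.taken (white-captures (Start.core start₁) j′)
    ... | record { w = rt ; taken = refl ; from = refl ; after = refl } = ⊥-elim (over js)
      where
      over : ∀ {s b″} → Jumps white V₂.after s b″ → ⊥
      over (one j′)    = Capture.taken (white-captures (Start.core start₂) j′)
      over (more j′ _) = Capture.taken (white-captures (Start.core start₂) j′)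
    replies (simpleMove n _) = ⊥-elim (n (_ , _ , _ , V₁.white-jump))

  -- One round of play.

  fork-child : ∀ M {L} → nth M 0 ≡ just L →
    drawn fork M ≡ fork × goᵘ fork M ≡ L × eps L ≡ eps M × del L ≡ not (del M)
  fork-child (inf ε δ) refl = refl , refl , refl , refl
  fork-child (fin h δ) e with h 0
  fork-child (fin h δ) refl | just t = refl , refl , refl , refl

  shape-join : ∀ j r → shape j r ≡ fork → ∃ λ r′ → r ≡ suc r′ × shape j r′ ≡ join
  shape-join zero    (suc zero)    _ = zero , refl , refl
  shape-join (suc j) (suc (suc r)) e with shape-join j r e
  ... | r′ , refl , e′ = suc (suc r′) , refl , e′

  module AtTheFork (k j : ℕ) {M L : Lane} (c : content k j ≡ M) (f : shapeAt k j ≡ fork)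
    (n : nth M 0 ≡ just L) where

    above : content k (suc j) ≡ L
    above = trans (content-upward k j f (λ ()) c) (proj₁ (proj₂ (fork-child M n)))

    block₁ : Block k j (cell (fromLeft k j) fork (eps M) (del M)) (cellAt (suc k) j)
      (cell (fromLeft k (suc j)) (drawn (shapeAt k (suc j)) L) (eps M) (not (del M)))
      (cellAt (suc k) (suc j))
    block₁ with fork-child M n
    ... | d , _ , ε≡ , δ≡ = block
      (trans (cellAt-≡ k j refl f c) (cong (λ s → cell (fromLeft k j) s (eps M) (del M)) d)) refl
      (trans (cellAt-≡ k (suc j) refl refl above) (cong₂ (cell _ _) ε≡ δ≡)) refl

    beside : shapeAt (suc k) j ≡ join
    beside with shape-join j (time k j) f
    ... | r′ , e , e′ = trans (cong (shape j) (time-tick k j e)) e′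

    beside-lane : content (suc k) j ≡ tail M
    beside-lane = content-straight k j f (λ ()) c

    escape : Lane
    escape = inf (not (eps M)) (del M)

    escape-lane : content (suc k) (suc j) ≡ escape
    escape-lane = trans (content-upward (suc k) j beside (λ ()) beside-lane)
      (cong₂ inf (cong not (goʳ-eps fork M)) (goʳ-del fork M))

    block₂ : Block k j (cell (fromLeft k j) fork (eps M) (del M))
      (cell (fromLeft (suc k) j) join (eps M) (del M)) (cellAt k (suc j))
      (cell (fromLeft (suc k) (suc j)) (drawn (shapeAt (suc k) (suc j)) escape) (not (eps M)) (del M))
    block₂ with fork-child M n
    ... | d , _ , _ , _ = block
      (trans (cellAt-≡ k j refl f c) (cong (λ s → cell (fromLeft k j) s (eps M) (del M)) d))
      (trans (cellAt-≡ (suc k) j refl beside beside-lane)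
        (cong₂ (cell _ _) (goʳ-eps fork M) (goʳ-del fork M)))
      refl (cellAt-≡ (suc k) (suc j) refl refl escape-lane)

    labels : ForkLabels (bit (eps M) + k * 10) (bit (del M) + j * 12)
    labels = fork-labels (eps M) (del M) block₁

    side : Free U³ (orgˣ (eps M) + k * 10) (bit (del M) + j * 12)
    side = free-side (eps M) (del M) block₁

  endClimbˣ : ∀ δ x → walkˣ (climb δ) x ≡ x
  endClimbˣ false x = refl
  endClimbˣ true  x = refl

  endClimbʸ : ∀ δ j → walkʸ (climb δ) (7 + bit δ + j * 12) ≡ bit (not δ) + suc j * 12
  endClimbʸ false j = refl
  endClimbʸ true  j = refl

  endDetourˣ : ∀ ε k → walkˣ (detour ε) (suc (orgˣ ε) + k * 10) ≡ orgˣ (not ε) + suc k * 10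
  endDetourˣ false k = refl
  endDetourˣ true  k = refl

  endDetourʸ : ∀ ε δ j → walkʸ (detour ε) (6 + bit δ + j * 12) ≡ bit δ + suc j * 12
  endDetourʸ false false j = refl
  endDetourʸ false true  j = refl
  endDetourʸ true  false j = refl
  endDetourʸ true  true  j = refl

  abstract

    trap : ∀ {b p x y} → Runner b p (3 + x) (4 + y) → ForkLabels x y →
      lab (sq (3 + x) (5 + y)) ≡ soft → ∃ λ b′ → ∃ λ p′ → Jump black b p b′ p′ × Trapped⁺ b′ x y
    trap {b} {p} {x} {y} r labels sf = b′ , _ , proj₁ (advance r up sf labEnd) , record
      { trapped = record
        { runner = subst (λ q → Runner b′ q (3 + x) (6 + y)) (land-at r up)
                     (proj₂ (advance r up sf labEnd))
        ; labels = labels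
        ; under  = trans (cong b′ (sym (next-at r up)))
            (leap-mid b p NW _ (differ {b} (next-is r up sf) (land-is r up labEnd) (λ ())))
        }
      ; slot = trans (leap-miss b p NW _ (left at) (left (next-at r up)) (left (land-at r up)))
                 (trans (ahead (inj₁ (s≤s (ℕ.n≤1+n _)))) (cong paint labSlot))
      ; q₂ = leap-keep b p NW _ (land-is r up labEnd)
               (trans (ahead (inj₂ (refl , ℕ.n<1+n _))) (cong paint labQ₂))
               (right at) (right (next-at r up))
      ; bar₂ = leap-keep b p NW _ (land-is r up labEnd)
               (trans (ahead (inj₁ (ℕ.n<1+n _))) (cong paint labBar₂))
               (right at) (right (next-at r up))
      }
      where
      open Runner r
      open ForkLabels labels
      b′ : Board
      b′ = leap b p NW (black , pawn)
      left : ∀ {y′ y″ q} → q ≡ sq (3 + x) y″ → sq (2 + x) y′ ≢ q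
      left refl = sq-≢ˣ (ℕ.<⇒≢ (ℕ.n<1+n _))
      right : ∀ {y′ y″ q} → q ≡ sq (3 + x) y″ → sq (4 + x) y′ ≢ q
      right refl = sq-≢ˣ (ℕ.<⇒≢ (ℕ.n<1+n _) ∘ sym)

  -- In one round Black makes a single iterated jump into the dead end of `L`. White's capture from
  -- above leads to `first`, his blunder to `second`.
  record Volley (b : Board) (L : Lane) : Set where
    field
      mid first second : Board
      attack   : Move ⟨ b , black ⟩ ⟨ mid , white ⟩
      blunder  : Move ⟨ mid , white ⟩ ⟨ second , black ⟩
      replies  : ∀ {t} → Move ⟨ mid , white ⟩ t → t ≡ ⟨ first , black ⟩ ⊎ t ≡ ⟨ second , black ⟩
      begin₁   : Begin first L
      {ε δ}    : Bool
      begin₂   : Begin second (inf ε δ)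

  abstract

    volley : ∀ n {b L L′} → Begin b L → nth L n ≡ just L′ → Volley b L′
    volley n {L′ = L′} B e with Begin.toOrigin B
    ... | _ , _ , _ , _ , jmp , path , o with reach n _ _ e o
    ... | M , record { k = k ; j = j ; path = path′ ; here = origin r c ; isFork = f } , e′
      with AtTheFork.side k j c f e′
    ... | s₁ , m₁ , s₂ , m₂ , s₃ , m₃ , _ with run (up ∷ up ∷ []) r (s₁ , m₁ , s₂ , m₂ , tt)
    ... | _ , _ , path″ , r′ with trap r′ (AtTheFork.labels k j c f e′) s₃
    ... | bD , _ , jmp′ , T = record
      { mid     = bD
      ; attack  = jumpMove (jumps jmp (path ⊕ (path′ ⊕ (path″ ⊕ (jmp′ ∷ [])))))
      ; blunder = jumpMove (one V₂.white-jump)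
      ; replies = replies
      ; begin₁  = record
          { k = k ; j = suc j ; start = start₁ ; free = free-climb (eps M) (del M) block₁
          ; endˣ = trans (endClimbˣ (del M) _) (cong (λ ε → orgˣ ε + k * 10) (sym ε≡))
          ; endʸ = trans (endClimbʸ (del M) j) (cong (λ δ → bit δ + suc j * 12) (sym δ≡))
          ; lane = above }
      ; begin₂  = record
          { k = suc k ; j = suc j ; start = start₂ ; free = free-detour (eps M) (del M) block₂
          ; endˣ = endDetourˣ (eps M) k ; endʸ = endDetourʸ (eps M) (del M) j ; lane = escape-lane }
      }
      where
      open Trapped⁺ T hiding (labels)
      open AtTheFork k j c f e′
      ε≡ : eps L′ ≡ eps M
      ε≡ = proj₁ (proj₂ (proj₂ (fork-child M e′)))
      δ≡ : del L′ ≡ not (del M)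
      δ≡ = proj₂ (proj₂ (proj₂ (fork-child M e′)))

  -- Lower bounds

  -- An infinite play starts here: in a corridor `inf` Black enters the first dead end and White
  -- blunders, which opens another corridor `inf`.
  data Endless : State → Set where
    base : ∀ {b ε δ} → Begin b (inf ε δ) → Endless ⟨ b , black ⟩
    _◅_  : ∀ {s t} → Move s t → Endless t → Endless s

  endless-move : ∀ {s} → Endless s → Σ State λ t → Move s t × Endless t
  endless-move (m ◅ e) = _ , m , e
  endless-move (base B)   = _ , attack , blunder ◅ base begin₂
    where open Volley (volley 0 B refl)

  endless-not-won : ∀ {s} → Endless s → ¬ AlreadyWon white s
  endless-not-won {s} e (_ , noInfinite) =
    noInfinite (proj₁ ∘ play) refl (λ n → proj₁ (proj₂ (endless-move (proj₂ (play n)))))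
    where
    play : ℕ → Σ State Endless
    play zero    = s , e
    play (suc n) = let t , _ , e′ = endless-move (proj₂ (play n)) in t , e′

  mutual

    -- Either reply opens a corridor `inf` again, so a derivation of a value would have to descend
    -- forever; it cannot stop at `won`, because an infinite play exists.
    inf-no-value : ∀ {b ε δ β} → Begin b (inf ε δ) → ¬ ValueAtMost white ⟨ b , black ⟩ β
    inf-no-value B (won w)         = endless-not-won (base B) w
    inf-no-value B (omove () _ _ _)
    inf-no-value B (cmove _ f)     =
      inf-no-value′ (volley 0 B refl) (f _ (Volley.attack (volley 0 B refl)))

    inf-no-value′ : ∀ {b ε δ β} (V : Volley b (inf ε δ)) →
                    ¬ ValueAtMost white ⟨ Volley.mid V , white ⟩ β
    inf-no-value′ V (won w)         = endless-not-won (Volley.blunder V ◅ base (Volley.begin₂ V)) w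
    inf-no-value′ V (cmove () _)
    inf-no-value′ V (omove _ m v _) with Volley.replies V m
    ... | inj₁ refl = inf-no-value (Volley.begin₁ V) v
    ... | inj₂ refl = inf-no-value (Volley.begin₂ V) v

  -- The blunder leads to a position without value, so White's move has to be the other capture,
  -- which costs one more than the child. The cases `won` fail because the blunder allows an
  -- infinite play.
  volley-value : ∀ {b L α β} → Volley b L →
    (∀ {b′ γ} → Begin b′ L → ValueAtMost white ⟨ b′ , black ⟩ γ → α ≤ₒ γ) →
                 ValueAtMost white ⟨ b , black ⟩ β → osuc α ≤ₒ β
  volley-value V least (won w) =
    ⊥-elim (endless-not-won (Volley.attack V ◅ (Volley.blunder V ◅ base (Volley.begin₂ V))) w)
  volley-value V least (omove () _ _ _)
  volley-value V least (cmove _ f) = reply (f _ (Volley.attack V))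
    where
    reply : ∀ {β} → ValueAtMost white ⟨ Volley.mid V , white ⟩ β → osuc _ ≤ₒ β
    reply (won w) = ⊥-elim (endless-not-won (Volley.blunder V ◅ base (Volley.begin₂ V)) w)
    reply (cmove () _)
    reply (omove _ m v l) with Volley.replies V m
    ... | inj₁ refl = ≤ₒ-trans (≤-suc (least (Volley.begin₁ V) v)) l
    ... | inj₂ refl = ⊥-elim (inf-no-value (Volley.begin₂ V) v)

  mutual

    lower : ∀ t {b δ β} → Begin b (grow δ t) → ValueAtMost white ⟨ b , black ⟩ β → ∣ t ∣ ≤ₒ β
    lower (node h) B v = ≤-limˡ λ n → lower⁺ (h n) n refl B v

    -- The entry `h n` becomes an argument `m` of its own to make the recursion structural.
    lower⁺ : ∀ m {h} n {b δ β} → h n ≡ m → Begin b (fin h δ) →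
             ValueAtMost white ⟨ b , black ⟩ β → ∣ m ∣⁺ ≤ₒ β
    lower⁺ nothing  n e B v = ≤-zero
    lower⁺ (just t) n {δ = δ} e B v =
      volley-value (volley n B (cong (Maybe.map (grow (not δ))) e)) (lower t) v

  -- Upper bounds

  calm-way : ∀ {X Y} → Calm X Y → ∀ w → lab (sq (gx w X) (gy w Y)) ≡ soft
  calm-way c rt = proj₁ c
  calm-way c up = proj₂ c

  module _ {b : Board} {p : Square} {X Y : ℕ} (r : Runner b p X Y) (Tb : Tight b None) where
    open Runner r

    captured : ∀ w → lab (sq (gx w X) (gy w Y)) ≡ soft → b (step (back w) p) ≡ nothing →
      Stuck ⟨ leap b (step (dir w) p) (back w) (white , pawn) , black ⟩
    captured w sf land = black-stuck (V.core (thawed (next-lab r w sf) λ ()))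
      (tight-white (next-is r w sf) V.mid′ V.land′ (next-lab r w sf) Tb)
      where module V = Capturing core on thaw w (next-is r w sf) land

    calm-reply : Calm X Y → (∃ λ w → b (step (back w) p) ≡ nothing) →
      ∀ {t} → Move ⟨ b , white ⟩ t → toMove t ≡ black × Stuck t
    calm-reply c _ (jumpMove (one j)) with white-captures core j
    ... | record { w = w ; taken = refl ; from = refl ; land = land ; after = refl } =
      refl , captured w (calm-way c w) land
    calm-reply c _ (jumpMove (more j js)) with white-captures core j
    ... | record { w = w ; taken = refl ; from = refl ; land = land ; after = refl } = ⊥-elim (over js)
      where
      module V = Capturing core on thaw w (next-is r w (calm-way c w)) land
      C′ : Core V.after None
      C′ = V.core (thawed (next-lab r w (calm-way c w)) λ ())
      over : ∀ {s b″} → Jumps white V.after s b″ → ⊥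
      over (one j′)    = Capture.taken (white-captures C′ j′)
      over (more j′ _) = Capture.taken (white-captures C′ j′)
    calm-reply c (w , land) (simpleMove n _) =
      ⊥-elim (n (_ , _ , _ , Capturing.white-jump core on thaw w (next-is r w (calm-way c w)) land))

    -- White has a capture and so must capture. As no idle pawn is unlocked by it, Black is stuck,
    -- and every play ends after this one move.
    calm-won : Calm X Y → (∃ λ w → b (step (back w) p) ≡ nothing) → AlreadyWon white ⟨ b , white ⟩
    calm-won c a@(w , land) = finite , infinite
      where
      reply : ∀ {t} → Move ⟨ b , white ⟩ t → toMove t ≡ black × Stuck t
      reply = calm-reply c a
      finite : ∀ t → Star Move ⟨ b , white ⟩ t → Stuck t → toMove t ≡ black
      finite _ done              s = ⊥-elim (s _ (jumpMove (one
        (Capturing.white-jump core on thaw w (next-is r w (calm-way c w)) land))))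
      finite _ (m then done)     s = proj₁ (reply m)
      finite _ (m then (m′ then _)) s = ⊥-elim (proj₂ (reply m) _ m′)
      infinite : (f : ℕ → State) → f 0 ≡ ⟨ b , white ⟩ → (∀ n → Move (f n) (f (suc n))) → ⊥
      infinite f e m = proj₂ (reply (subst (λ s → Move s (f 1)) e (m 0))) _ (m 1)

  -- The counterpart of `Begin` when White has not blundered: `Tight` holds, the unlocked pawn is an
  -- `idle₁`, and the corridor is a `fin`.
  record Begin⁺ (b : Board) (h : ℕ → Maybe Tree) (δ : Bool) : Set where
    field
      p     : Square
      X Y   : ℕ
      ds    : List Way
      k j   : ℕ
      start : Start b p rt X Y
      label : lab p ≡ idle₁
      tight : Tight b (_≡ p)
      track : Track ds X Y
      endˣ  : walkˣ ds X ≡ 3 + k * 10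
      endʸ  : walkʸ ds Y ≡ bit δ + j * 12
      lane  : content k j ≡ fin h δ

  Upper : Tree → Set
  Upper t = ∀ {b δ} → Begin⁺ b (branch t) δ → ValueAtMost white ⟨ b , black ⟩ ∣ t ∣

  -- The induction hypothesis for the children still ahead of the runner. With `α` fixed, passing a
  -- fork only drops the entry `h 0`.
  Good : Ord → (ℕ → Maybe Tree) → Set
  Good α h = ∀ n {t} → h n ≡ just t → osuc ∣ t ∣ ≤ₒ α × Upper t

  record Live (α : Ord) (x y : ℕ) : Set where
    field
      {k j} : ℕ
      {h}   : ℕ → Maybe Tree
      {δ}   : Bool
      {t}   : Tree
      lane  : content k j ≡ fin h δ
      shp   : shapeAt k j ≡ fork
      child : h 0 ≡ just t
      atˣ   : x ≡ k * 10
      atʸ   : y ≡ bit δ + j * 12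
      good  : Good α h

    open AtTheFork k j lane shp (cong (Maybe.map (grow (not δ))) child) public

    wall : Walls x y
    wall = subst₂ Walls (sym atˣ) (sym atʸ) (walls δ block₁)

    sides : Free U³ (3 + x) y
    sides = subst₂ (λ x y → Free U³ (3 + x) y) (sym atˣ) (sym atʸ) side

    forkLabels : ForkLabels x y
    forkLabels = subst₂ ForkLabels (sym atˣ) (sym atʸ) labels

  record Target (α : Ord) (ds : List Way) (X Y : ℕ) : Set where
    constructor target
    field
      k j  : ℕ
      {h}  : ℕ → Maybe Tree
      {δ}  : Bool
      endˣ : walkˣ ds X ≡ 3 + k * 10
      endʸ : walkʸ ds Y ≡ bit δ + j * 12
      lane : content k j ≡ fin h δ
      good : Good α h

  -- The holes a runner in a corridor fin h can reach, indexed by the direction in which he arrives.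
  data Spot (α : Ord) : Way → ℕ → ℕ → Set where
    main  : ∀ {w X Y} ds → Track ds X Y → Target α ds X Y → Spot α w X Y
    side₂ : ∀ {x y} → Live α x y → Spot α up (3 + x) (2 + y)
    side₄ : ∀ {x y} → Live α x y → Spot α up (3 + x) (4 + y)
    side₆ : ∀ {x y} → Live α x y → Spot α up (3 + x) (6 + y)

  Next : Ord → ℕ → ℕ → Way → Set
  Next α X Y w = lab (sq (gx w X) (gy w Y)) ≡ soft × Spot α w (gx w (gx w X)) (gy w (gy w Y))

  Open : ℕ → ℕ → Way → Set
  Open X Y w = lab (sq (gx w (gx w X)) (gy w (gy w Y))) ≡ empty

  along : ∀ {α X Y} w ds → Track (w ∷ ds) X Y → Target α (w ∷ ds) X Y →
          ∀ w′ → Open X Y w′ → Next α X Y w′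
  along rt ds (c , _ , _ , tr) (target k j ex ey ln g) rt o =
    proj₁ c , main ds tr (target k j ex ey ln g)
  along up ds (c , _ , _ , tr) (target k j ex ey ln g) up o =
    proj₂ c , main ds tr (target k j ex ey ln g)
  along rt ds (_ , _ , n , _)  _ up o = ⊥-elim (n o)
  along up ds (_ , _ , n , _)  _ rt o = ⊥-elim (n o)

  drawn-dead : ∀ {h δ} → h 0 ≡ nothing → drawn fork (fin h δ) ≡ straight
  drawn-dead {h} e with h 0
  drawn-dead refl | nothing = refl

  from-origin : ∀ {α} k j {h δ} → content k j ≡ fin h δ → Good α h → ∀ w →
    Open (3 + k * 10) (bit δ + j * 12) w → Next α (3 + k * 10) (bit δ + j * 12) w
  from-origin k j {h} {δ} c g w o with shapeAt k j in e
  ... | straight = along rt R⁴ (track-straight _ δ (block-rt k j c e λ ()))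
                     (target (suc k) j refl refl (content-straight k j e (λ ()) c) g) w o
  ... | join     = along rt R⁴ (track-join _ δ (block-rt k j c e λ ()))
                     (target (suc k) j refl refl (content-straight k j e (λ ()) c) g) w o
  ... | upward   = along up U⁵ (track-upward δ (block-up k j c e λ ()))
                     (target k (suc j) refl (endU⁶ δ j) (content-upward k j e (λ ()) c) g) w o
  ... | fork with h 0 in e₀
  ... | nothing  = along rt R⁴ (track-straight _ δ blk)
                     (target (suc k) j refl refl (content-straight k j e (λ ()) c) (g ∘ suc)) w o
    where
    blk : Block k j (cell (fromLeft k j) straight false δ) _ _ _
    blk with block-rt k j c e (λ ())
    ... | block e₀₀ e₁₀ e₀₁ e₁₁ =
      block (trans e₀₀ (cong (λ s → cell (fromLeft k j) s false δ) (drawn-dead {h} {δ} e₀))) e₁₀ e₀₁ e₁₁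
  ... | just t = branching w o
    where
    live : Live _ (k * 10) (bit δ + j * 12)
    live = record
      { k = k ; j = j ; lane = c ; shp = e ; child = e₀ ; atˣ = refl ; atʸ = refl ; good = g }
    blk : Block k j (cell (fromLeft k j) fork false δ) _ _ _
    blk with block-rt k j c e (λ ())
    ... | block e₀₀ e₁₀ e₀₁ e₁₁ = block (trans e₀₀ (cong (λ s → cell (fromLeft k j) s false δ)
        (proj₁ (fork-child (fin h δ) (cong (Maybe.map (grow (not δ))) e₀))))) e₁₀ e₀₁ e₁₁
    branching : ∀ w → Open (3 + k * 10) (bit δ + j * 12) w → Next _ (3 + k * 10) (bit δ + j * 12) w
    branching rt _ = proj₁ (calm-origin fork δ blk) ,
      main R⁴ (track-fork _ δ blk)
        (target (suc k) j refl refl (content-straight k j e (λ ()) c) (g ∘ suc))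
    branching up _ = proj₂ (calm-origin fork δ blk) , side₂ live

  -- The spots are closed under every jump open to the runner, so wherever Black ends his iterated
  -- jump, it is at a spot.
  follow : ∀ {α w X Y} → Spot α w X Y → ∀ w′ → Open X Y w′ → Next α X Y w′
  follow (main [] _ (target k j refl refl ln g)) w′ o = from-origin k j ln g w′ o
  follow (main (w″ ∷ ds) tr tg) w′ o = along w″ ds tr tg w′ o
  follow (side₂ l) up o = proj₁ (proj₂ (proj₂ (Live.sides l))) , side₄ l
  follow (side₂ l) rt o = ⊥-elim (Walls.wall₂ (Live.wall l) o)
  follow (side₄ l) up o = proj₁ (proj₂ (proj₂ (proj₂ (proj₂ (Live.sides l))))) , side₆ l
  follow (side₄ l) rt o = ⊥-elim (Walls.wall₄ (Live.wall l) o)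
  follow (side₆ l) up o = ⊥-elim (Walls.roof (Live.wall l) o)
  follow (side₆ l) rt o = ⊥-elim (Walls.wall₆ (Live.wall l) o)

  calm-at : ∀ {α X Y} ds → Track ds X Y → Target α ds X Y → Calm X Y
  calm-at (_ ∷ _) (c , _) _ = c
  calm-at [] _ (target k j {δ = δ} refl refl ln _) =
    calm-origin _ δ (block {k} {j} (cellAt-≡ k j refl refl ln) refl refl refl)

  record On (α : Ord) (b : Board) (p : Square) : Set where
    field
      {w}    : Way
      {X Y}  : ℕ
      spot   : Spot α w X Y
      runner : Runner b p X Y
      tight  : Tight b None
      behind : b (step (back w) p) ≡ nothing

  paint-empty : ∀ l → paint l ≡ nothing → l ≡ empty
  paint-empty empty _ = refl

  next-on : ∀ {α b p s b′ s′} → On α b p → Jump black b s b′ s′ → On α b′ s′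
  next-on {α} {b} {p} o j with black-jumps (Runner.core (On.runner o)) (On.tight o) j
  ... | record { who = inj₂ () }
  ... | record { w = w ; who = inj₁ refl ; isB = isB ; isW = isW ; land = land
               ; after = refl ; there = refl } =
    record
    { w      = w
    ; spot   = proj₂ nxt
    ; runner = hop r w isW land (thawed (next-lab r w (proj₁ nxt)) λ ())
                 (thawed (land-lab r w opn) λ ())
    ; tight  = tight-black isB isW land (next-lab r w (proj₁ nxt)) (land-lab r w opn) (On.tight o)
    ; behind = trans (cong (leap b p (dir w) (black , pawn)) (back-step w _))
                 (leap-mid b p (dir w) _ (differ {b} isW land λ ()))
    }
    where
    r : Runner b p (On.X o) (On.Y o)
    r = On.runner o
    opn : Open (On.X o) (On.Y o) w
    opn = paint-empty _ (trans (sym (land-is r w refl)) land)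
    nxt : Next α (On.X o) (On.Y o) w
    nxt = follow (On.spot o) w opn

  -- Only one pawn is unlocked, because the vacated gate lies two steps NE of that pawn and of no
  -- other.
  tight₁ : ∀ {b x y} (T : Trapped b x y) → Tight b None →
           Tight (Trapped.V₁.after T) (_≡ sq (1 + x) (7 + y))
  tight₁ {b} {x} {y} T Tb = Leap.tight {d = SE} isW V₁.mid′ V₁.land′ Tb
    (λ l → lab-differ l isGate (λ ()) , differ {b} (Tight.firm Tb l) V₁.mid′ wp≢bp)
    gates (λ ()) (λ ())
    where
    open Trapped T
    isW : b (step NW (sq (3 + x) (6 + y))) ≡ wp
    isW = next-is runner up labGate₁
    isGate : lab (step NW (sq (3 + x) (6 + y))) ≡ gate
    isGate = next-lab runner up labGate₁
    gates : ∀ {p} → lab p ≡ idle₁ → b (step NE p) ≡ wp → b (step NE (step NE p)) ≡ wp →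
      p ≡ sq (1 + x) (7 + y) ⊎
      ((step NE p ≢ V₁.s × step NE p ≢ step SE V₁.s) ×
       (step NE (step NE p) ≢ V₁.s × step NE (step NE p) ≢ step SE V₁.s))
    gates {p} l e f with p ≟ˢ sq (1 + x) (7 + y)
    ... | yes q = inj₁ q
    ... | no  n = inj₂
      ((lab-differ (proj₁ (bar-gate l)) isGate (λ ()) , differ {b} e V₁.mid′ wp≢bp) ,
       ((λ q → n (step-injective rt (step-injective rt 
          (trans q (trans gate₁ (sym (step-sq² rt (1 + x) (7 + y)))))))) ,
        differ {b} f V₁.mid′ wp≢bp))

  -- If the runner stops halfway in a side branch, the capture from above leaves Black stuck, so the
  -- value is at most 1. Side branches exist only for children, which makes `α` at least 1 wherever
  -- this is applied.
  caught : ∀ {b p X Y α} → Runner b p X Y → Tight b None → lab (sq X (suc Y)) ≡ soft →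
    b (step SE p) ≡ nothing → osuc ozero ≤ₒ α → ValueAtMost white ⟨ b , white ⟩ α
  caught r Tb sf land le = omove refl
    (jumpMove (one (Capturing.white-jump (Runner.core r) (Runner.on r) (Runner.thaw r) up
      (next-is r up sf) land)))
    (cmove {α = ozero} refl λ t m → ⊥-elim (captured r Tb up sf land t m)) le

  stop : ∀ {α b p} → On α b p → ValueAtMost white ⟨ b , white ⟩ α
  stop record { spot = main ds tr tg ; runner = r ; tight = Tb ; behind = bh } =
    won (calm-won r Tb (calm-at ds tr tg) (_ , bh))
  stop record { spot = side₂ l ; runner = r ; tight = Tb ; behind = bh } =
    caught r Tb (proj₁ (proj₂ (proj₂ (Live.sides l)))) bh
      (≤ₒ-trans (≤-suc ≤-zero) (proj₁ (Live.good l 0 (Live.child l))))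
  stop record { spot = side₄ l ; runner = r ; tight = Tb ; behind = bh } =
    caught r Tb (proj₁ (proj₂ (proj₂ (proj₂ (proj₂ (Live.sides l)))))) bh
      (≤ₒ-trans (≤-suc ≤-zero) (proj₁ (Live.good l 0 (Live.child l))))
  stop {b = b} record { spot = side₆ l@(record { k = k ; j = j ; δ = δ ; atˣ = refl ; atʸ = refl })
                      ; runner = r ; tight = Tb ; behind = bh } with Runner.at r
  ... | refl = omove refl (jumpMove (one (Trapped.V₁.white-jump trapped)))
    (proj₂ (Live.good l 0 (Live.child l)) record
      { k = k ; j = suc j ; start = Trapped.start₁ trapped ; label = Trapped.labQ₁ trapped
      ; tight = tight₁ trapped Tb
      ; track = track-climb δ (Live.block₁ l) ; endˣ = endClimbˣ δ _ ; endʸ = endClimbʸ δ j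
      ; lane = Live.above l })
    (proj₁ (Live.good l 0 (Live.child l)))
    where
    trapped : Trapped b (k * 10) (bit δ + j * 12)
    trapped = record { runner = r ; labels = Live.forkLabels l ; under = bh }

  finish : ∀ {α b p s b″} → On α b p → Jumps black b s b″ → ValueAtMost white ⟨ b″ , white ⟩ α
  finish o (one j)     = stop (next-on o j)
  finish o (more j js) = finish (next-on o j) js

  module _ {α : Ord} {b : Board} {h : ℕ → Maybe Tree} {δ : Bool} (B : Begin⁺ b h δ) (g : Good α h) where
    open Begin⁺ B
    open Start start hiding (launch)

    first-on : ∀ {s b′ s′} → Jump black b s b′ s′ → On α b′ s′
    first-on jmp with black-jumps core tight jmp
    ... | record { who = inj₂ (refl , refl) ; after = refl ; there = refl } = record
      { w      = rt
      ; spot   = main ds track (target k j endˣ endʸ lane g)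
      ; runner = proj₂ (Start.launch start)
      ; tight  = Leap.tight {d = NE} on lock land tight
          (λ l → lab-differ l label (λ ()) , lab-differ l (proj₁ (bar-gate label)) (λ ()))
          (λ l _ f → inj₂
            ((lab-differ (proj₁ (bar-gate l)) label (λ ()) ,
              -- If the two bars coincided, so would the gates; but one gate is open and the other
              -- holds a white pawn.
              λ q → case (trans (sym f) (trans (cong (b ∘ step NE) q) land))) ,
             (lab-differ (proj₂ (bar-gate l)) label (λ ()) ,
              lab-differ (proj₂ (bar-gate l)) (proj₁ (bar-gate label)) (λ ()))))
          inj₁ (λ _ l → case′ (trans (sym (proj₂ (bar-gate label))) l))
      ; behind = trans (cong (leap b p NE (black , pawn)) (back-step rt (step NE p)))
                   (leap-mid b p NE (black , pawn) (differ {b} lock land λ ()))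
      }
      where
      case : wp ≢ nothing
      case ()
      case′ : gate ≢ idle₁
      case′ ()

    upper-move : ∀ t → Move ⟨ b , black ⟩ t → ValueAtMost white t α
    upper-move _ (jumpMove (one jmp))     = stop (first-on jmp)
    upper-move _ (jumpMove (more jmp js)) = finish (first-on jmp) js
    upper-move _ (simpleMove n _)         = ⊥-elim (n (_ , _ , _ , proj₁ (Start.launch start)))

  mutual

    upper : ∀ t → Upper t
    upper (node h) B = cmove refl (upper-move B λ n e →
      ≤ₒ-trans (least n e) (branch-≤ (node h) n) , upper⁺ (h n) e)
      where
      least : ∀ n {t} → h n ≡ just t → osuc ∣ t ∣ ≤ₒ ∣ h n ∣⁺
      least n e rewrite e = ≤ₒ-refl _

    upper⁺ : ∀ m {t} → m ≡ just t → Upper t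
    upper⁺ (just t) refl = upper t

  -- The initial position and its value.

  -- The position after White's capture from above at the fork of the cell (0 , 0).
  initial : Board
  initial = set B₀ (sq 3 7) nothing

  module Root = AtTheFork 0 0 {fin (λ _ → just root) false} {grow true root} refl refl refl
  open ForkLabels Root.labels

  initial-miss : ∀ {p l} → lab p ≡ l → l ≢ gate → initial p ≡ paint l
  initial-miss {p} e n = trans
    (set-miss B₀ nothing λ { refl → n (trans (sym e) labGate₁) }) (cong paint e)

  initial-inv : ∀ {p ρ} → initial p ≡ just ρ → paint (lab p) ≡ just ρ
  initial-inv {p} e with p ≟ˢ sq 3 7
  ... | no _ = e

  paint-pawn : ∀ l {c κ} → paint l ≡ just (c , κ) → κ ≡ pawn
  paint-pawn soft  refl = refl
  paint-pawn hard  refl = refl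
  paint-pawn hard₂ refl = refl
  paint-pawn bar   refl = refl
  paint-pawn gate  refl = refl
  paint-pawn idle₁ refl = refl
  paint-pawn idle₂ refl = refl
  paint-pawn idleˡ refl = refl
  paint-pawn idleʳ refl = refl

  paint-black : ∀ l → paint l ≡ bp → Idle l
  paint-black idle₁ _ = isIdle₁
  paint-black idle₂ _ = isIdle₂
  paint-black idleˡ _ = isIdleˡ
  paint-black idleʳ _ = isIdleʳ

  initial-start : Start initial (sq 1 7) rt 3 7
  initial-start = record
    { core  = record
        { pawns  = λ {p} e → paint-pawn (lab p) (initial-inv {p} e)
        ; frozen = λ {p} f → initial-miss {p} refl λ e → gate-thawed (subst Frozen e f)
        ; blacks = λ {p} e → inj₂ (paint-black (lab p) (initial-inv {p} e)) }
    ; on    = initial-miss labQ₁ λ ()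
    ; lock  = initial-miss labBar₁ λ ()
    ; land  = set-hit B₀ (sq 3 7) nothing
    ; at    = refl
    ; ahead = λ {x} {y} a → set-miss B₀ nothing (out-self a)
    ; thaw  = thawed labQ₁ λ ()
    ; thaw₁ = thawed labBar₁ λ ()
    ; thaw₂ = thawed labGate₁ λ ()
    }
    where
    gate-thawed : ¬ Frozen gate
    gate-thawed ()

  initial-begin : Begin initial (grow true root)
  initial-begin = record
    { ds = U³ ; k = 0 ; j = 1 ; start = initial-start ; free = free-climb false false Root.block₁
    ; endˣ = refl ; endʸ = refl ; lane = refl }

  initial-begin⁺ : Begin⁺ initial (branch root) true
  initial-begin⁺ = record
    { ds = U³ ; k = 0 ; j = 1 ; start = initial-start ; label = labQ₁
    ; tight = record { firm = λ l → initial-miss l λ () ; shut = shut }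
    ; track = track-climb false Root.block₁ ; endˣ = refl ; endʸ = refl ; lane = refl }
    where
    shut : ∀ {p} → lab p ≡ idle₁ → initial p ≡ bp →
           p ≡ sq 1 7 ⊎ (initial (step NE p) ≡ wp × initial (step NE (step NE p)) ≡ wp)
    shut {p} l _ with p ≟ˢ sq 1 7
    ... | yes e = inj₁ e
    ... | no  n = inj₂ (initial-miss (proj₁ (bar-gate l)) (λ ()) ,
      trans (set-miss B₀ nothing λ e → n (step-injective rt (step-injective rt e)))
            (cong paint (proj₂ (bar-gate l))))

  initial-value : HasValue white ⟨ initial , black ⟩ ∣ root ∣
  initial-value = upper root initial-begin⁺ , λ _ → lower root initial-begin

theorem3p6 : (α : Ord) → Σ Colour λ O → Σ State λ st → HasValue O st α
theorem3p6 α = white , _ , HasValue-resp-≈ (∣tree∣≈ α) (Arena.initial-value (tree α))
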